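{- Finite suprema need not exist in $\mathsf{Log}$: there are logics $\vdash$ and $\vdash'$ such that $[\vdash]$ and $[\vdash']$ have no supremum in $\mathsf{Log}$.
   Context: A logic $\vdash$ is a substitution-invariant consequence relation on the set of formulas, in some infinite cardinal of variables, of a language without constants. $\mathrm{Mod}^{\equiv}(\vdash)$ is the class of matrices $\langle \mathbf{A}, F\rangle$ such that $F$ is a deductive filter of $\vdash$ on $\mathbf{A}$ and the Suszko congruence of $F$ relative to $\vdash$ is the identity. An interpretation of $\vdash$ into $\vdash'$ is a translation $\tau$ (assigning to each $n$-ary symbol of the language of $\vdash$ an $n$-ary formula of the language of $\vdash'$) such that $\langle \mathbf{A}^{\tau}, F\rangle \in \mathrm{Mod}^{\equiv}(\vdash)$ for all $\langle \mathbf{A}, F\rangle \in \mathrm{Mod}^{\equiv}(\vdash')$, where $\mathbf{A}^\tau$ interprets symbols via their translations; write $\vdash \leq \vdash'$ if one exists. $[\vdash]$ is the class of logics equi-interpretable with $\vdash$, and $\mathsf{Log}$ is the poset of these classes ordered by interpretability. -}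

module Defs where

open import Level using (Level; _⊔_) renaming (suc to lsuc)
open import Data.Nat using (ℕ; _≤_)
open import Data.Fin using (Fin)
open import Data.Product using (Σ; Σ-syntax; ∃; _×_; _,_)
open import Relation.Nullary using (¬_)
open import Relation.Unary using (Pred; _∈_; _⊆_)
open import Relation.Binary using (Rel; IsEquivalence)
open import Relation.Binary.PropositionalEquality using (_≡_)
open import Function.Bundles using (_↣_)

record Signature (ℓ : Level) : Set (lsuc ℓ) where
  field
    Sym     : Set ℓ
    ar      : Sym → ℕ
    noConst : ∀ f → 1 ≤ ar f
open Signature public

data Term {ℓ ℓ′ : Level} (L : Signature ℓ) (V : Set ℓ′) : Set (ℓ ⊔ ℓ′) where
  var : V → Term L V
  node : (f : Sym L) → (Fin (ar L f) → Term L V) → Term L V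

substT : ∀ {ℓ ℓ′ ℓ″} {L : Signature ℓ} {V : Set ℓ′} {W : Set ℓ″} →
         (V → Term L W) → Term L V → Term L W
substT σ (var x) = σ x
substT σ (node f ts) = node f (λ i → substT σ (ts i))

record Algebra {ℓ : Level} (L : Signature ℓ) (a : Level) : Set (ℓ ⊔ lsuc a) where
  field
    Carrier : Set a
    op      : (f : Sym L) → (Fin (ar L f) → Carrier) → Carrier
open Algebra public

eval : ∀ {ℓ ℓ′ a} {L : Signature ℓ} {V : Set ℓ′} (A : Algebra L a) →
       (V → Carrier A) → Term L V → Carrier A
eval A v (var x) = v x
eval A v (node f ts) = op A f (λ i → eval A v (ts i))

record Logic (ℓ : Level) : Set (lsuc ℓ) where
  field
    lang     : Signature ℓ
    Var      : Set ℓ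
    infVar   : ℕ ↣ Var
    _⊢_      : Pred (Term lang Var) ℓ → Term lang Var → Set ℓ
    reflex   : ∀ {Γ φ} → φ ∈ Γ → Γ ⊢ φ
    monot    : ∀ {Γ Δ φ} → Γ ⊆ Δ → Γ ⊢ φ → Δ ⊢ φ
    cut      : ∀ {Γ Δ φ} → (∀ {ψ} → ψ ∈ Δ → Γ ⊢ ψ) → Δ ⊢ φ → Γ ⊢ φ
    substInv : ∀ {Γ φ} (σ : Var → Term lang Var) → Γ ⊢ φ →
               (λ ψ → Σ[ χ ∈ Term lang Var ] (χ ∈ Γ × ψ ≡ substT σ χ)) ⊢ substT σ φ
open Logic public

Fm : ∀ {ℓ} → Logic ℓ → Set ℓ
Fm 𝓛 = Term (lang 𝓛) (Var 𝓛)

module _ {ℓ : Level} (𝓛 : Logic ℓ) where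

  IsFilter : (A : Algebra (lang 𝓛) ℓ) → Pred (Carrier A) ℓ → Set (lsuc ℓ)
  IsFilter A F = ∀ (Γ : Pred (Fm 𝓛) ℓ) (φ : Fm 𝓛) (v : Var 𝓛 → Carrier A) →
                 (𝓛 ⊢ Γ) φ → (∀ ψ → ψ ∈ Γ → eval A v ψ ∈ F) → eval A v φ ∈ F

  IsCongruence : (A : Algebra (lang 𝓛) ℓ) → Rel (Carrier A) ℓ → Set ℓ
  IsCongruence A θ = IsEquivalence θ ×
    (∀ f (as bs : Fin (ar (lang 𝓛) f) → Carrier A) →
       (∀ i → θ (as i) (bs i)) → θ (op A f as) (op A f bs))

  Compatible : (A : Algebra (lang 𝓛) ℓ) → Rel (Carrier A) ℓ → Pred (Carrier A) ℓ → Set ℓ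
  Compatible A θ G = ∀ a b → θ a b → a ∈ G → b ∈ G

  -- Suszko congruence of F relative to 𝓛: the largest congruence compatible
  -- with every deductive filter of 𝓛 on A containing F (i.e. the union of all
  -- such congruences).
  Suszko : (A : Algebra (lang 𝓛) ℓ) → Pred (Carrier A) ℓ →
           Carrier A → Carrier A → Set (lsuc ℓ)
  Suszko A F a b = Σ[ θ ∈ Rel (Carrier A) ℓ ]
    (IsCongruence A θ ×
     (∀ (G : Pred (Carrier A) ℓ) → IsFilter A G → F ⊆ G → Compatible A θ G) ×
     θ a b)

  InModS : (A : Algebra (lang 𝓛) ℓ) → Pred (Carrier A) ℓ → Set (lsuc ℓ)
  InModS A F = IsFilter A F × (∀ a b → Suszko A F a b → a ≡ b)

Translation : ∀ {ℓ} → Signature ℓ → Signature ℓ → Set ℓ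
Translation L L′ = (f : Sym L) → Term L′ (Fin (ar L f))

_^[_] : ∀ {ℓ} {L L′ : Signature ℓ} → Algebra L′ ℓ → Translation L L′ → Algebra L ℓ
Carrier (A ^[ τ ]) = Carrier A
op (A ^[ τ ]) f as = eval A as (τ f)

IsInterpretation : ∀ {ℓ : Level} (𝓛 𝓛′ : Logic ℓ) → Translation (lang 𝓛) (lang 𝓛′) → Set (lsuc ℓ)
IsInterpretation {ℓ} 𝓛 𝓛′ τ =
  ∀ (A : Algebra (lang 𝓛′) ℓ) (F : Pred (Carrier A) ℓ) →
    InModS 𝓛′ A F → InModS 𝓛 (A ^[ τ ]) F

_≤ᴵ_ : ∀ {ℓ} → Logic ℓ → Logic ℓ → Set (lsuc ℓ)
𝓛 ≤ᴵ 𝓛′ = Σ[ τ ∈ Translation (lang 𝓛) (lang 𝓛′) ] IsInterpretation 𝓛 𝓛′ τ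

IsSup : ∀ {ℓ} → Logic ℓ → Logic ℓ → Logic ℓ → Set (lsuc ℓ)
IsSup 𝓛 𝓛′ 𝓢 = (𝓛 ≤ᴵ 𝓢) × (𝓛′ ≤ᴵ 𝓢) ×
  (∀ (𝓤 : Logic _) → 𝓛 ≤ᴵ 𝓤 → 𝓛′ ≤ᴵ 𝓤 → 𝓢 ≤ᴵ 𝓤)

HasSup : ∀ {ℓ} → Logic ℓ → Logic ℓ → Set (lsuc ℓ)
HasSup 𝓛 𝓛′ = Σ[ 𝓢 ∈ Logic _ ] IsSup 𝓛 𝓛′ 𝓢

-- A least upper bound would have a language of fixed size, whereas the upper bounds built here need
-- arbitrarily many unary operations, the probes.  cyclic two and cyclic three ask for a unary turn of
-- order two, respectively three.  In upper I both turns act on pairs of elements that differ in one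
-- bit, and in opposite directions: the square of turn two sets the bit and the cube of turn three
-- clears it.  Each of the two cyclic logics alone separates such a pair, a logic interpreting both
-- does not, unless it can send the bit to the designated set, and in the model with parameter i only
-- the probe i can do that.  By Cantor's diagonal argument the translation of a bound 𝓢 into upper I,
-- for I = Sym × ℕ → Bool, misses some probe i.  Rigidity of a gadget on which the turns have exact
-- order two and three forces the translated turns to be the given ones, so 𝓢 must identify the pairs
-- in the i-th model, although that model is reduced for 𝓢.
--
-- Quotients are not available, so that a rule of 𝓢 cannot be read off from the cyclic logics.
-- Instead, a set of elements of a finite algebra 𝔸 is shown not to be a filter of 𝓢, and the
-- derivation witnessing this (up to double negation) is lifted to the i-th model.  All operations of
-- upper I are unary: without function extensionality its filters could not control binary ones.

module Submission where

open import Defs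
open import Level using (Level; Lift; lift; lower) renaming (suc to lsuc)
open import Data.Bool using (Bool; true; false; not; T; _∧_; _∨_)
open import Data.Bool.Properties using (not-¬)
open import Data.Bool.ListAction using (all; any)
open import Data.Empty using (⊥-elim) renaming (⊥ to ⊥₀)
open import Data.Empty.Polymorphic using (⊥) renaming (⊥-elim to ⊥ᵖ-elim)
open import Data.Fin using (Fin; zero)
open import Data.List using (List; []; _∷_; _++_; map)
open import Data.List.Properties using (map-cong)
open import Data.List.Relation.Unary.All using (All; []; _∷_; lookup)
open import Data.List.Relation.Unary.All.Properties using (++⁺; all⁺)
open import Data.List.Membership.Propositional using () renaming (_∈_ to _∈ˡ_)
open import Data.List.Relation.Unary.Any using (here; there; satisfied)
open import Data.List.Relation.Unary.Any.Properties using (any⁻)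
open import Data.Maybe using (Maybe; just; nothing; is-just)
open import Data.Nat using (ℕ; zero; suc; s≤s; z≤n)
open import Data.Product using (Σ-syntax; ∃; _×_; _,_; proj₁; proj₂)
open import Data.Sum using (_⊎_; inj₁; inj₂; [_,_])
open import Data.Unit.Polymorphic using (⊤; tt)
open import Function using (_∘_; id)
open import Function.Bundles using (mk↣)
open import Relation.Binary using (Rel; IsEquivalence)
open import Relation.Binary.PropositionalEquality
  using (_≡_; _≢_; refl; sym; trans; cong; subst; subst₂)
open import Relation.Nullary using (¬_)
open import Relation.Unary using (Pred; _∈_; _⊆_)

-- The cyclic logics and their filters

data Order : Set where
  two three : Order

iter : ∀ {a} {A : Set a} → Order → (A → A) → A → A
iter two   f x = f (f x)
iter three f x = f (f (f x))

iter-natural : ∀ {a b} {A : Set a} {B : Set b} (h : A → B) {f : A → A} {g : B → B} →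
               (∀ x → h (f x) ≡ g (h x)) → ∀ o x → h (iter o f x) ≡ iter o g (h x)
iter-natural h {f} {g} hf two   x = trans (hf (f x)) (cong g (hf x))
iter-natural h {f} {g} hf three x =
  trans (hf (f (f x))) (cong g (trans (hf (f x)) (cong g (hf x))))

app : ∀ {ℓ a} {L : Signature ℓ} (A : Algebra L a) → Sym L → Carrier A → Carrier A
app A f x = op A f (λ _ → x)

unary : ∀ {ℓ ℓ′} {L : Signature ℓ} {V : Set ℓ′} → Sym L → Term L V → Term L V
unary f φ = node f (λ _ → φ)

eval-substT : ∀ {ℓ ℓ′ ℓ″ a} {L : Signature ℓ} {V : Set ℓ′} {W : Set ℓ″} (A : Algebra L a) →
              (∀ f as bs → (∀ i → as i ≡ bs i) → op A f as ≡ op A f bs) →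
              (σ : V → Term L W) (v : W → Carrier A) (φ : Term L V) →
              eval A v (substT σ φ) ≡ eval A (eval A v ∘ σ) φ
eval-substT A ext σ v (var x)     = refl
eval-substT A ext σ v (node f ts) = ext f _ _ (λ i → eval-substT A ext σ v (ts i))

module _ (ℓ : Level) where

  -- `copy` and `name` act through congruences rather than rules: a congruence of a reduct of an
  -- upper bound respects them, which `run-step` and `foreign-step` rely on.
  data CyclicSym : Set ℓ where
    truth turn copy name : CyclicSym

  cyclicSig : Signature ℓ
  cyclicSig = record { Sym = CyclicSym ; ar = λ _ → 1 ; noConst = λ _ → s≤s z≤n }

  private
    Form : Set ℓ
    Form = Term cyclicSig (Lift ℓ ℕ)

  -- `absurd` makes the order exact: in a proper filter a value of `truth` stays designated after
  -- `o` turns, and one further turn must leave the filter. Thus the identity cannot serve as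
  -- `turn`.
  data Entails (o : Order) (Γ : Pred Form ℓ) : Form → Set ℓ where
    hyp    : ∀ {φ} → φ ∈ Γ → Entails o Γ φ
    truthᵢ : ∀ χ → Entails o Γ (unary truth χ)
    turnᵢ  : ∀ {φ} → Entails o Γ φ → Entails o Γ (iter o (unary turn) φ)
    absurd : ∀ {χ φ} → Entails o Γ (unary turn (iter o (unary turn) (unary truth χ))) →
             Entails o Γ φ

  Entails-cut : ∀ {o Γ Δ φ} → (∀ {ψ} → ψ ∈ Δ → Entails o Γ ψ) → Entails o Δ φ → Entails o Γ φ
  Entails-cut h (hyp x)    = h x
  Entails-cut h (truthᵢ χ) = truthᵢ χ
  Entails-cut h (turnᵢ d)  = turnᵢ (Entails-cut h d)
  Entails-cut h (absurd d) = absurd (Entails-cut h d)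

  substT-iter : (σ : Lift ℓ ℕ → Form) (o : Order) (φ : Form) →
                substT σ (iter o (unary turn) φ) ≡ iter o (unary turn) (substT σ φ)
  substT-iter σ = iter-natural (substT σ) (λ _ → refl)

  Entails-subst : ∀ {o Γ φ} (σ : Lift ℓ ℕ → Form) → Entails o Γ φ →
                  Entails o (λ ψ → Σ[ χ ∈ Form ] (χ ∈ Γ × ψ ≡ substT σ χ)) (substT σ φ)
  Entails-subst σ (hyp x)    = hyp (_ , x , refl)
  Entails-subst σ (truthᵢ χ) = truthᵢ (substT σ χ)
  Entails-subst {o} σ (turnᵢ {φ} d) =
    subst (Entails o _) (sym (substT-iter σ o φ)) (turnᵢ (Entails-subst σ d))
  Entails-subst {o} σ (absurd {χ} d) =
    absurd {χ = substT σ χ}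
      (subst (Entails o _) (cong (unary turn) (substT-iter σ o (unary truth χ))) (Entails-subst σ d))

  cyclic : Order → Logic ℓ
  cyclic o = record
    { lang     = cyclicSig
    ; Var      = Lift ℓ ℕ
    ; infVar   = mk↣ {to = lift} (λ { refl → refl })
    ; _⊢_      = Entails o
    ; reflex   = hyp
    ; monot    = λ s → Entails-cut (λ x → hyp (s x))
    ; cut      = Entails-cut
    ; substInv = Entails-subst
    }

  -- Three closure conditions on elements replace the quantifier over derivations and valuations, so
  -- that auxiliary filters can be checked by hand.
  record CyclicFilter (o : Order) (A : Algebra cyclicSig ℓ) (G : Pred (Carrier A) ℓ) : Set ℓ where
    field
      has-truth : ∀ x → G (app A truth x)
      has-turn  : ∀ x → G x → G (iter o (app A turn) x)
      explodes  : ∀ x y → G (app A turn (iter o (app A turn) (app A truth x))) → G y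

  module _ {o : Order} (A : Algebra cyclicSig ℓ) {G : Pred (Carrier A) ℓ} where

    eval-iter : ∀ (v : Lift ℓ ℕ → Carrier A) φ →
                eval A v (iter o (unary turn) φ) ≡ iter o (app A turn) (eval A v φ)
    eval-iter v = iter-natural (eval A v) (λ _ → refl) o

    fromCyclicFilter : CyclicFilter o A G → IsFilter (cyclic o) A G
    fromCyclicFilter F Γ φ v d h = go d
      where
      open CyclicFilter F
      go : ∀ {φ} → Entails o Γ φ → G (eval A v φ)
      go (hyp x)          = h _ x
      go (truthᵢ χ)       = has-truth _
      go (turnᵢ {φ} d)    = subst G (sym (eval-iter v φ)) (has-turn _ (go d))
      go (absurd {χ} d)   =
        explodes (eval A v χ) _ (subst G (cong (app A turn) (eval-iter v (unary truth χ))) (go d))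

    toCyclicFilter : IsFilter (cyclic o) A G → CyclicFilter o A G
    toCyclicFilter fil = record
      { has-truth = λ x → fil (λ _ → ⊥) (unary truth x₀) (λ _ → x) (truthᵢ x₀) λ _ ()
      ; has-turn  = λ x g → subst G (eval-iter (λ _ → x) x₀)
          (fil (_≡ x₀) (iter o (unary turn) x₀) (λ _ → x) (turnᵢ (hyp refl)) λ { _ refl → g })
      ; explodes  = λ x y g →
          fil (_≡ θ) x₁ (λ { (lift zero) → x ; (lift (suc _)) → y }) (absurd {χ = x₀} (hyp refl))
            λ { _ refl → subst G (sym (cong (app A turn) (eval-iter _ (unary truth x₀)))) g }
      }
      where
      x₀ x₁ θ : Form
      x₀ = var (lift 0)
      x₁ = var (lift 1)
      θ  = unary turn (iter o (unary turn) (unary truth x₀))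

-- The gadget: turn two swaps 𝟏 and α, turn three cycles 𝟏, β₁, β₂; Ω absorbs and is designated,
-- ∞ absorbs and is not.
data Gad : Set where
  𝟏 α β₁ β₂ Ω ∞ 𝟏′ Ω′ Ω″ : Gad

T-≡ : ∀ {b c} → (T b → T c) → (T c → T b) → b ≡ c
T-≡ {false} {false} f g = refl
T-≡ {false} {true}  f g = ⊥-elim (g _)
T-≡ {true}  {false} f g = ⊥-elim (f _)
T-≡ {true}  {true}  f g = refl

data Letter : Set where
  truth copy name restore probe : Letter
  turn : Order → Letter

actG : Letter → Gad → Gad
actG truth _ = 𝟏
actG (turn two) 𝟏  = α
actG (turn two) α  = 𝟏
actG (turn two) β₁ = Ω
actG (turn two) β₂ = Ω
actG (turn two) Ω  = Ω
actG (turn two) ∞  = ∞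
actG (turn two) 𝟏′ = 𝟏′
actG (turn two) Ω′ = Ω′
actG (turn two) Ω″ = Ω
actG (turn three) 𝟏  = β₁
actG (turn three) α  = ∞
actG (turn three) β₁ = β₂
actG (turn three) β₂ = 𝟏
actG (turn three) Ω  = Ω
actG (turn three) ∞  = ∞
actG (turn three) 𝟏′ = 𝟏′
actG (turn three) Ω′ = Ω′
actG (turn three) Ω″ = Ω
actG copy 𝟏  = 𝟏′
actG copy α  = ∞
actG copy β₁ = ∞
actG copy β₂ = ∞
actG copy Ω  = Ω′
actG copy ∞  = ∞
actG copy 𝟏′ = Ω′
actG copy Ω′ = Ω′
actG copy Ω″ = Ω′
actG name 𝟏  = Ω″
actG name α  = ∞
actG name β₁ = ∞
actG name β₂ = ∞
actG name Ω  = Ω″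
actG name ∞  = ∞
actG name 𝟏′ = Ω″
actG name Ω′ = Ω″
actG name Ω″ = Ω″
actG restore 𝟏  = Ω
actG restore α  = ∞
actG restore β₁ = Ω
actG restore β₂ = Ω
actG restore Ω  = Ω
actG restore ∞  = ∞
actG restore 𝟏′ = 𝟏
actG restore Ω′ = Ω
actG restore Ω″ = Ω
actG probe 𝟏  = Ω
actG probe α  = ∞
actG probe β₁ = Ω
actG probe β₂ = Ω
actG probe Ω  = Ω
actG probe ∞  = ∞
actG probe 𝟏′ = Ω
actG probe Ω′ = Ω
actG probe Ω″ = Ω

-- Rigidity of the gadget

-- The carrier of the finite algebra `𝔸`: the gadget and one point for each value of a bit. The
-- turns set and clear the bit, all other letters forget it.
data Pt : Set where
  gad : Gad → Pt
  pt  : Bool → Pt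

actP : Letter → Pt → Pt
actP l            (gad x) = gad (actG l x)
actP truth        (pt b)  = gad 𝟏
actP copy         (pt b)  = gad Ω′
actP name         (pt b)  = gad Ω″
actP restore      (pt b)  = gad Ω
actP probe        (pt b)  = gad Ω
actP (turn two)   (pt b)  = pt true
actP (turn three) (pt b)  = pt false

runG : List Letter → Gad → Gad
runG []      x = x
runG (l ∷ w) x = runG w (actG l x)

runP : List Letter → Pt → Pt
runP []      x = x
runP (l ∷ w) x = runP w (actP l x)

-- Exhaustive checks and normal forms of words

pattern here₀ = here refl
pattern here₁ = there here₀
pattern here₂ = there here₁
pattern here₃ = there here₂
pattern here₄ = there here₃
pattern here₅ = there here₄
pattern here₆ = there here₅
pattern here₇ = there here₆
pattern here₈ = there here₇

record Finite (A : Set) : Set where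
  field
    elements : List A
    complete : ∀ x → x ∈ˡ elements

  every : (A → Bool) → Bool
  every P = all P elements

  every-sound : ∀ P → T (every P) → ∀ x → T (P x)
  every-sound P t x = lookup (all⁺ P elements t) (complete x)

-- The powers of one turn up to equality on `Pt`. Neither `two₂` nor `three₃` equals `idle`: the
-- former sends `β₁` to `Ω`, the latter `α` to `∞`. One more turn leads back to `two₁` or `three₁`.
data Pure : Set where
  idle two₁ two₂ three₁ three₂ three₃ : Pure

pureWord : Pure → List Letter
pureWord idle   = []
pureWord two₁   = turn two ∷ []
pureWord two₂   = turn two ∷ turn two ∷ []
pureWord three₁ = turn three ∷ []
pureWord three₂ = turn three ∷ turn three ∷ []
pureWord three₃ = turn three ∷ turn three ∷ turn three ∷ []

-- The last letter other than a turn decides where the values of a word that is not a power of one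
-- turn lie: in the gadget, among the copies, or among the names.
data Mode : Set where
  main copies names : Mode

gads : Finite Gad
gads = record
  { elements = 𝟏 ∷ α ∷ β₁ ∷ β₂ ∷ Ω ∷ ∞ ∷ 𝟏′ ∷ Ω′ ∷ Ω″ ∷ []
  ; complete = λ { 𝟏 → here₀ ; α → here₁ ; β₁ → here₂ ; β₂ → here₃ ; Ω → here₄ ; ∞ → here₅
                 ; 𝟏′ → here₆ ; Ω′ → here₇ ; Ω″ → here₈ }
  }

letters : Finite Letter
letters = record
  { elements = truth ∷ copy ∷ name ∷ restore ∷ probe ∷ turn two ∷ turn three ∷ []
  ; complete = λ { truth → here₀ ; copy → here₁ ; name → here₂ ; restore → here₃ ; probe → here₄
                 ; (turn two) → here₅ ; (turn three) → here₆ }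
  }

pures : Finite Pure
pures = record
  { elements = idle ∷ two₁ ∷ two₂ ∷ three₁ ∷ three₂ ∷ three₃ ∷ []
  ; complete = λ { idle → here₀ ; two₁ → here₁ ; two₂ → here₂ ; three₁ → here₃ ; three₂ → here₄
                 ; three₃ → here₅ }
  }

modes : Finite Mode
modes = record
  { elements = main ∷ copies ∷ names ∷ []
  ; complete = λ { main → here₀ ; copies → here₁ ; names → here₂ }
  }

open Finite using (every; every-sound; elements)

designated : Gad → Bool
designated 𝟏 = true
designated Ω = true
designated _ = false

isTruth : Letter → Bool
isTruth truth = true
isTruth _     = false

isMain : Mode → Bool
isMain main = true
isMain _    = false

next : Letter → Mode → Mode
next copy     _      = copies
next name     _      = names
next (turn _) copies = copies
next _        _      = main

isTop : Mode → Gad → Bool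
isTop main   Ω  = true
isTop copies Ω′ = true
isTop names  Ω″ = true
isTop _      _  = false

isBottom : Gad → Bool
isBottom ∞ = true
isBottom _ = false

onCycle : Gad → Bool
onCycle 𝟏  = true
onCycle α  = true
onCycle β₁ = true
onCycle β₂ = true
onCycle _  = false

sameOnCycle : Gad → Gad → Bool
sameOnCycle 𝟏  𝟏  = true
sameOnCycle α  α  = true
sameOnCycle β₁ β₁ = true
sameOnCycle β₂ β₂ = true
sameOnCycle _  _  = false

dead : Mode → Gad → Bool
dead μ x = isTop μ x ∨ isBottom x

known : Mode → Gad → Bool
known main   x  = onCycle x ∨ dead main x
known copies 𝟏′ = true
known μ      x  = dead μ x

-- At most one cycle element survives under f.
record Collapsing (μ : Mode) (f : Gad → Gad) : Set where
  field
    focus  : Gad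
    at-Ω   : T (isTop μ (f Ω))
    at-∞   : T (isBottom (f ∞))
    cycle  : ∀ x → T (not (onCycle x) ∨ known μ (f x))
    others : ∀ x → T ((not (onCycle x) ∨ sameOnCycle x focus) ∨ dead μ (f x))
    range  : ∀ x → T (isMain μ ∨ known μ (f x))

collapses : Mode → (Gad → Gad) → Gad → Bool
collapses μ f c =
  isTop μ (f Ω) ∧ isBottom (f ∞) ∧
  every gads (λ x → not (onCycle x) ∨ known μ (f x)) ∧
  every gads (λ x → (not (onCycle x) ∨ sameOnCycle x c) ∨ dead μ (f x)) ∧
  every gads (λ x → isMain μ ∨ known μ (f x))

private
  fstᵀ : ∀ a {b} → T (a ∧ b) → T a
  fstᵀ true _ = _

  sndᵀ : ∀ a {b} → T (a ∧ b) → T b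
  sndᵀ true x = x

  ∨-map : ∀ a b c → (T b → T c) → T (a ∨ b) → T (a ∨ c)
  ∨-map true  b c f _ = _
  ∨-map false b c f x = f x

  mp : ∀ a b → T (not a ∨ b) → T a → T b
  mp true b t _ = t

collapsing : ∀ {μ f} c → T (collapses μ f c) → Collapsing μ f
collapsing {μ} {f} c t = record
  { focus  = c
  ; at-Ω   = fstᵀ p₁ t
  ; at-∞   = fstᵀ p₂ t₂
  ; cycle  = every-sound gads (λ x → not (onCycle x) ∨ known μ (f x)) (fstᵀ p₃ t₃)
  ; others = every-sound gads (λ x → (not (onCycle x) ∨ sameOnCycle x c) ∨ dead μ (f x)) (fstᵀ p₄ t₄)
  ; range  = every-sound gads (λ x → isMain μ ∨ known μ (f x)) (sndᵀ p₄ t₄)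
  }
  where
  p₁ = isTop μ (f Ω)
  p₂ = isBottom (f ∞)
  p₃ = every gads (λ x → not (onCycle x) ∨ known μ (f x))
  p₄ = every gads (λ x → (not (onCycle x) ∨ sameOnCycle x c) ∨ dead μ (f x))
  t₂ = sndᵀ p₁ t
  t₃ = sndᵀ p₂ t₂
  t₄ = sndᵀ p₃ t₃

not-truth : ∀ l → l ≢ truth → ∀ {b} → T (isTruth l ∨ b) → T b
not-truth truth    ne t = ⊥-elim (ne refl)
not-truth copy     ne t = t
not-truth name     ne t = t
not-truth restore  ne t = t
not-truth probe    ne t = t
not-truth (turn _) ne t = t

module _ (B : Mode → Gad → Bool) where

  -- Tests on all letters but `truth`, all modes and all elements whether `B` is an invariant of
  -- values. For the predicates in `Collapsing-step` the test evaluates to `true`, so `_` proves it.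
  stable : Bool
  stable = every letters λ l → isTruth l ∨
           every modes λ μ → every gads λ x → not (B μ x) ∨ B (next l μ) (actG l x)

  stable-step : T stable → ∀ l → l ≢ truth → ∀ μ x → T (B μ x) → T (B (next l μ) (actG l x))
  stable-step t l ne μ x = mp (B μ x) _
    (every-sound gads (λ x → not (B μ x) ∨ B (next l μ) (actG l x))
      (every-sound modes (λ μ → every gads λ x → not (B μ x) ∨ B (next l μ) (actG l x))
        (not-truth l ne (every-sound letters (λ l → isTruth l ∨
           every modes λ μ → every gads λ x → not (B μ x) ∨ B (next l μ) (actG l x)) t l)) μ) x)

-- Appending a letter changes only the values of `f`. So the focus stays, and each condition follows
-- from the stability of one predicate on values.
Collapsing-step : ∀ l → l ≢ truth → ∀ {μ f} → Collapsing μ f → Collapsing (next l μ) (actG l ∘ f)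
Collapsing-step l ne {μ} {f} C = record
  { focus  = focus
  ; at-Ω   = stable-step isTop _ l ne μ (f Ω) at-Ω
  ; at-∞   = stable-step (λ _ → isBottom) _ l ne μ (f ∞) at-∞
  ; cycle  = λ x → ∨-map (not (onCycle x)) _ _ (stable-step known _ l ne μ (f x)) (cycle x)
  ; others = λ x → ∨-map (not (onCycle x) ∨ sameOnCycle x focus) _ _
                     (stable-step dead _ l ne μ (f x)) (others x)
  ; range  = λ x → stable-step (λ μ x → isMain μ ∨ known μ x) _ l ne μ (f x) (range x)
  }
  where open Collapsing C

extend : Letter → Pure → Maybe Pure
extend (turn two)   idle   = just two₁
extend (turn two)   two₁   = just two₂
extend (turn two)   two₂   = just two₁
extend (turn three) idle   = just three₁
extend (turn three) three₁ = just three₂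
extend (turn three) three₂ = just three₃
extend (turn three) three₃ = just three₁
extend _            _      = nothing

extend-sound : ∀ l q q′ → extend l q ≡ just q′ → ∀ p →
               actP l (runP (pureWord q) p) ≡ runP (pureWord q′) p
extend-sound (turn two)   idle   _ refl p = refl
extend-sound (turn two)   two₁   _ refl p = refl
extend-sound (turn two)   two₂   _ refl (pt b) = refl
extend-sound (turn two)   two₂   _ refl (gad 𝟏) = refl
extend-sound (turn two)   two₂   _ refl (gad α) = refl
extend-sound (turn two)   two₂   _ refl (gad β₁) = refl
extend-sound (turn two)   two₂   _ refl (gad β₂) = refl
extend-sound (turn two)   two₂   _ refl (gad Ω) = refl
extend-sound (turn two)   two₂   _ refl (gad ∞) = refl
extend-sound (turn two)   two₂   _ refl (gad 𝟏′) = refl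
extend-sound (turn two)   two₂   _ refl (gad Ω′) = refl
extend-sound (turn two)   two₂   _ refl (gad Ω″) = refl
extend-sound (turn three) idle   _ refl p = refl
extend-sound (turn three) three₁ _ refl p = refl
extend-sound (turn three) three₂ _ refl p = refl
extend-sound (turn three) three₃ _ refl (pt b) = refl
extend-sound (turn three) three₃ _ refl (gad 𝟏) = refl
extend-sound (turn three) three₃ _ refl (gad α) = refl
extend-sound (turn three) three₃ _ refl (gad β₁) = refl
extend-sound (turn three) three₃ _ refl (gad β₂) = refl
extend-sound (turn three) three₃ _ refl (gad Ω) = refl
extend-sound (turn three) three₃ _ refl (gad ∞) = refl
extend-sound (turn three) three₃ _ refl (gad 𝟏′) = refl
extend-sound (turn three) three₃ _ refl (gad Ω′) = refl
extend-sound (turn three) three₃ _ refl (gad Ω″) = refl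

module _ (l : Letter) (q : Pure) where

  private
    collapsesAt : Gad → Bool
    collapsesAt = collapses (next l main) (actG l ∘ runG (pureWord q))

  extendsOrCollapses : Bool
  extendsOrCollapses = is-just (extend l q) ∨ any collapsesAt (elements gads)

  extendsOrCollapses-sound : T extendsOrCollapses →
    ∃ (λ q′ → extend l q ≡ just q′) ⊎ Collapsing (next l main) (actG l ∘ runG (pureWord q))
  extendsOrCollapses-sound t with extend l q
  ... | just q′ = inj₁ (q′ , refl)
  ... | nothing with satisfied (any⁻ collapsesAt (elements gads) t)
  ...   | c , t′ = inj₂ (collapsing c t′)

-- Mixing the two turns, or using `copy`, `name`, `restore` or `probe`, leaves at most one cycle
-- element alive; a search through the gadget finds the focus.
pure-step : ∀ l → l ≢ truth → ∀ q →
  ∃ (λ q′ → extend l q ≡ just q′) ⊎ Collapsing (next l main) (actG l ∘ runG (pureWord q))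
pure-step l ne q = extendsOrCollapses-sound l q
  (every-sound pures (extendsOrCollapses l)
    (not-truth l ne (every-sound letters (λ l → isTruth l ∨ every pures (extendsOrCollapses l)) _ l)) q)

runP-gad : ∀ w x → runP w (gad x) ≡ gad (runG w x)
runP-gad []      x = refl
runP-gad (l ∷ w) x = runP-gad w (actG l x)

gad-injective : ∀ {x y} → Pt.gad x ≡ gad y → x ≡ y
gad-injective refl = refl

-- Only `pure` records the action on `Pt`, since the other two kinds are refuted on the gadget
-- alone. `constant` arises from `truth`.
data Kind (f : Pt → Pt) (f′ : Gad → Gad) : Set where
  pure     : ∀ q → (∀ p → f p ≡ runP (pureWord q) p) → (∀ x → f′ x ≡ runG (pureWord q) x) → Kind f f′
  spread   : ∀ μ → Collapsing μ f′ → Kind f f′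
  constant : ∀ c → (∀ x → f′ x ≡ c) → Kind f f′

Collapsing-cong : ∀ {μ f g} → (∀ x → f x ≡ g x) → Collapsing μ g → Collapsing μ f
Collapsing-cong {μ} {f} {g} e C = record
  { focus  = focus
  ; at-Ω   = subst (T ∘ isTop μ) (sym (e Ω)) at-Ω
  ; at-∞   = subst (T ∘ isBottom) (sym (e ∞)) at-∞
  ; cycle  = λ x → subst (λ y → T (not (onCycle x) ∨ known μ y)) (sym (e x)) (cycle x)
  ; others = λ x → subst (λ y → T ((not (onCycle x) ∨ sameOnCycle x focus) ∨ dead μ y)) (sym (e x)) (others x)
  ; range  = λ x → subst (λ y → T (isMain μ ∨ known μ y)) (sym (e x)) (range x)
  }
  where open Collapsing C

truth? : (l : Letter) → l ≡ truth ⊎ l ≢ truth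
truth? truth    = inj₁ refl
truth? copy     = inj₂ λ ()
truth? name     = inj₂ λ ()
truth? restore  = inj₂ λ ()
truth? probe    = inj₂ λ ()
truth? (turn _) = inj₂ λ ()

Kind-step : ∀ l {f f′} → Kind f f′ → Kind (actP l ∘ f) (actG l ∘ f′)
Kind-step l k with truth? l
... | inj₁ refl = constant 𝟏 λ _ → refl
Kind-step l (spread μ C) | inj₂ ne = spread (next l μ) (Collapsing-step l ne C)
Kind-step l (constant c e) | inj₂ ne = constant (actG l c) (cong (actG l) ∘ e)
Kind-step l (pure q e e′) | inj₂ ne with pure-step l ne q
... | inj₂ C = spread (next l main) (Collapsing-cong (cong (actG l) ∘ e′) C)
... | inj₁ (q′ , ext) = pure q′ (λ p → trans (cong (actP l) (e p)) (extend-sound l q q′ ext p))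
  λ x → trans (cong (actG l) (e′ x)) (gad-injective
    (trans (cong (actP l) (sym (runP-gad (pureWord q) x)))
      (trans (extend-sound l q q′ ext (gad x)) (runP-gad (pureWord q′) x))))

classify : ∀ w {f f′} → Kind f f′ → Kind (runP w ∘ f) (runG w ∘ f′)
classify []      k = k
classify (l ∷ w) k = classify w (Kind-step l k)

-- The inverse rotation `three₂` also has exact order three, so `turn three` is determined only up
-- to inversion. On the points both rotations clear the bit.
data Turns : Order → Pure → Set where
  two₁   : Turns two two₁
  three₁ : Turns three three₁
  three₂ : Turns three three₂

module _ {o : Order} {f : Gad → Gad} (closed : ∀ x → T (designated x) → T (designated (iter o f x)))
         {c : Gad} (dc : T (designated c)) (escapes : ¬ T (designated (f (iter o f c)))) where

  private
    dx : T (designated (iter o f c))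
    dx = closed c dc

  -- A fixed point reached within two steps equals `iter o f c` for either order, and then one more
  -- application of `f` cannot escape.
  settles : ∀ {z} → f (f c) ≡ z → f z ≡ z → ⊥₀
  settles {z} e e′ = escapes (subst (T ∘ designated) (trans (value o) (sym (trans (cong f (value o)) e′))) dx)
    where
    value : ∀ o → iter o f c ≡ z
    value two   = e
    value three = trans (cong f e) e′

  -- Outside `main` no known element is designated, whereas `iter o f c` is a designated value of
  -- `f`.
  lands : ∀ μ → T (not (isMain μ)) → (∀ x → T (known μ (f x))) → ⊥₀
  lands μ m k = go μ (iter o f c) m (last o) dx
    where
    last : ∀ o → T (known μ (iter o f c))
    last two   = k _
    last three = k _
    go : ∀ μ y → T (not (isMain μ)) → T (known μ y) → T (designated y) → ⊥₀
    go copies 𝟏 _ () _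
    go copies Ω _ () _
    go names  𝟏 _ () _
    go names  Ω _ () _

  ¬collapsing : ∀ {μ} → Collapsing μ f → ⊥₀
  ¬collapsing {copies} C = lands copies _ (Collapsing.range C)
  ¬collapsing {names}  C = lands names _ (Collapsing.range C)
  ¬collapsing {main}   C = start c dc refl
    where
    open Collapsing C
    fixed : ∀ y → T (dead main y) → f y ≡ y
    fixed Ω _ with f Ω | at-Ω
    ... | Ω | _ = refl
    fixed ∞ _ with f ∞ | at-∞
    ... | ∞ | _ = refl
    elsewhere : ∀ y c′ {b} {_ : T (onCycle y ∧ not (sameOnCycle y 𝟏))} → T (sameOnCycle 𝟏 c′ ∨ false) →
                T ((not (onCycle y) ∨ sameOnCycle y c′) ∨ b) → T b
    elsewhere α  𝟏 _ t = t
    elsewhere β₁ 𝟏 _ t = t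
    elsewhere β₂ 𝟏 _ t = t
    dies : ∀ {x} → T (dead main (f x)) → x ≡ f c → ⊥₀
    dies {x} d refl = settles refl (fixed (f x) d)
    start : ∀ x → T (designated x) → x ≡ c → ⊥₀
    start Ω _ refl = settles (trans (cong f (fixed Ω _)) (fixed Ω _)) (fixed Ω _)
    start 𝟏 _ refl with f 𝟏 in e | cycle 𝟏 | others 𝟏
    ... | Ω | _ | _ = settles (trans (cong f e) (fixed Ω _)) (fixed Ω _)
    ... | ∞ | _ | _ = settles (trans (cong f e) (fixed ∞ _)) (fixed ∞ _)
    ... | 𝟏 | _ | _ = settles (trans (cong f e) e) e
    -- Here `f 𝟏` is alive, so `𝟏` is the focus. Hence `f` kills the cycle element `f 𝟏`, and
    -- `f (f 𝟏)` is a fixed point.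
    ... | α  | _ | o′ = dies (elsewhere α focus o′ (others α)) (sym e)
    ... | β₁ | _ | o′ = dies (elsewhere β₁ focus o′ (others β₁)) (sym e)
    ... | β₂ | _ | o′ = dies (elsewhere β₂ focus o′ (others β₂)) (sym e)

iter-cong : ∀ {a} {A : Set a} {f g : A → A} → (∀ x → f x ≡ g x) → ∀ o x → iter o f x ≡ iter o g x
iter-cong {f = f} {g} e two   x = trans (e (f x)) (cong g (e x))
iter-cong {f = f} {g} e three x = trans (e _) (cong g (iter-cong e two x))

pure-turns : ∀ o q → (∀ x → T (designated x) → T (designated (iter o (runG (pureWord q)) x))) →
             ∀ c → T (designated c) → ¬ T (designated (runG (pureWord q) (iter o (runG (pureWord q)) c))) →
             Turns o q
pure-turns two   two₁   _ _ _ _ = two₁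
pure-turns three three₁ _ _ _ _ = three₁
pure-turns three three₂ _ _ _ _ = three₂
pure-turns two   idle   _ c d e = ⊥-elim (e d)
pure-turns three idle   _ c d e = ⊥-elim (e d)
pure-turns two   two₂   _ 𝟏 _ e = ⊥-elim (e _)
pure-turns two   two₂   _ Ω _ e = ⊥-elim (e _)
pure-turns two   three₁ h _ _ _ = ⊥-elim (h 𝟏 _)
pure-turns two   three₂ h _ _ _ = ⊥-elim (h 𝟏 _)
pure-turns two   three₃ _ 𝟏 _ e = ⊥-elim (e _)
pure-turns two   three₃ _ Ω _ e = ⊥-elim (e _)
pure-turns three two₁   h _ _ _ = ⊥-elim (h 𝟏 _)
pure-turns three two₂   _ 𝟏 _ e = ⊥-elim (e _)
pure-turns three two₂   _ Ω _ e = ⊥-elim (e _)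
pure-turns three three₃ _ 𝟏 _ e = ⊥-elim (e _)
pure-turns three three₃ _ Ω _ e = ⊥-elim (e _)

-- The hypotheses concern the gadget only, but the classification of words carries the conclusion
-- over to the two points.
rigid : ∀ o w → (∀ x → T (designated x) → T (designated (iter o (runG w) x))) →
        ∀ c → T (designated c) → ¬ T (designated (runG w (iter o (runG w) c))) →
        ∃ λ q → Turns o q × (∀ p → runP w p ≡ runP (pureWord q) p)
rigid o w closed c dc escapes with classify w {id} {id} (pure idle (λ _ → refl) (λ _ → refl))
... | spread μ C   = ⊥-elim (¬collapsing {o} closed dc escapes C)
... | constant d e = ⊥-elim (settles {o} closed dc escapes (e _) (e _))
... | pure q e e′  = q
    , pure-turns o q
        (λ x d → subst (T ∘ designated) (iter-cong e′ o x) (closed x d)) c dc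
        (λ t → escapes (subst (T ∘ designated) (sym (trans (cong (runG w) (iter-cong e′ o c)) (e′ _))) t))
    , e

-- Words over a unary signature

run : ∀ {ℓ a} {L : Signature ℓ} (A : Algebra L a) → List (Sym L) → Carrier A → Carrier A
run A []      x = x
run A (f ∷ w) x = run A w (app A f x)

run-++ : ∀ {ℓ a} {L : Signature ℓ} (A : Algebra L a) (w w′ : List (Sym L)) (x : Carrier A) →
         run A (w ++ w′) x ≡ run A w′ (run A w x)
run-++ A []      w′ x = refl
run-++ A (f ∷ w) w′ x = run-++ A w w′ (app A f x)

runF : ∀ {ℓ ℓ′} {L : Signature ℓ} {V : Set ℓ′} → List (Sym L) → Term L V → Term L V
runF []      φ = φ
runF (f ∷ w) φ = runF w (unary f φ)

eval-runF : ∀ {ℓ ℓ′ a} {L : Signature ℓ} {V : Set ℓ′} (A : Algebra L a) (v : V → Carrier A)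
            (w : List (Sym L)) (φ : Term L V) → eval A v (runF w φ) ≡ run A w (eval A v φ)
eval-runF A v []      φ = refl
eval-runF A v (f ∷ w) φ = eval-runF A v w (unary f φ)

-- The upper bounds

module _ {ℓ : Level} (I : Set ℓ) where

  data USym : Set ℓ where
    truth copy name restore : USym
    turn  : Order → USym
    probe : I → USym

  letter : USym → Letter
  letter truth     = truth
  letter copy      = copy
  letter name      = name
  letter restore   = restore
  letter (turn o)  = turn o
  letter (probe k) = probe

  upperSig : Signature ℓ
  upperSig = record { Sym = USym ; ar = λ _ → 1 ; noConst = λ _ → s≤s z≤n }

  -- Each class indexes a pair of elements differing in one bit. The turns act on the bit of a
  -- copied pair `cop X`, and probe `k` sends every copied pair to the pair `tag k`.
  data Cls : Set ℓ where
    tag : I → Cls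
    cop : Cls → Cls

  data El : Set ℓ where
    gad  : Gad → El
    bit  : Cls → Bool → El
    star : Cls → El

  act : USym → El → El
  act f            (gad x)         = gad (actG (letter f) x)
  act truth        _               = gad 𝟏
  act copy         (bit X b)       = bit (cop X) b
  act copy         (star X)        = gad Ω′
  act name         (bit X b)       = star X
  act name         (star X)        = gad Ω″
  act restore      _               = gad Ω
  act (turn two)   (bit (cop X) b) = bit (cop X) true
  act (turn three) (bit (cop X) b) = bit (cop X) false
  act (turn _)     _               = gad Ω
  act (probe k)    (bit (cop X) b) = bit (tag k) b
  act (probe k)    _               = gad Ω

  𝔹 : Algebra upperSig ℓ
  𝔹 = record { Carrier = El ; op = λ f as → act f (as zero) }

  -- The class of tag i with bit false is the only undesignated tag; E names at most one
  -- additional designated star.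
  D : I → Maybe Cls → El → Set ℓ
  D i E        (gad 𝟏)             = ⊤
  D i E        (gad Ω)             = ⊤
  D i (just _) (gad Ω″)            = ⊤
  D i E        (gad _)             = ⊥
  D i E        (bit (tag j) true)  = ⊤
  D i E        (bit (tag j) false) = ¬ j ≡ i
  D i E        (bit (cop X) b)     = ⊥
  D i E        (star X)            = E ≡ just X

  -- The variables `arg` allow a formula whose value is definitionally `op C f as` for an arbitrary
  -- function `as` on `Fin 1`; see `op-app`.
  data UVar : Set ℓ where
    arg : Fin 1 → UVar
    num : ℕ → UVar

  UForm : Set ℓ
  UForm = Term upperSig UVar

  -- Defined semantically, so that rules need only be verified in `𝔹` and every `D i E` is a filter
  -- at once. The sets `D i (just X)` are there to tell the stars apart.
  _⊩_ : Pred UForm ℓ → UForm → Set ℓ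
  Γ ⊩ φ = ∀ i E (v : UVar → El) → (∀ ψ → ψ ∈ Γ → D i E (eval 𝔹 v ψ)) → D i E (eval 𝔹 v φ)

  upper : Logic ℓ
  upper = record
    { lang     = upperSig
    ; Var      = UVar
    ; infVar   = mk↣ {to = num} (λ { refl → refl })
    ; _⊢_      = _⊩_
    ; reflex   = λ x i E v h → h _ x
    ; monot    = λ s d i E v h → d i E v (λ ψ x → h ψ (s x))
    ; cut      = λ Δ d i E v h → d i E v (λ ψ x → Δ x i E v h)
    ; substInv = λ {Γ} {φ} σ d i E v h →
        subst (D i E) (sym (eval-𝔹 σ v φ))
          (d i E (eval 𝔹 v ∘ σ) λ ψ x → subst (D i E) (eval-𝔹 σ v ψ) (h _ (ψ , x , refl)))
    }
    where
    eval-𝔹 : ∀ (σ : UVar → UForm) v φ → eval 𝔹 v (substT σ φ) ≡ eval 𝔹 (eval 𝔹 v ∘ σ) φ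
    eval-𝔹 = eval-substT 𝔹 (λ f as bs e → cong (act f) (e zero))

  -- All operations are monotone for this relation and all `D i E` are upward closed, so an
  -- inequality between two values yields a rule of `upper`, also after further letters.
  data _≼_ : El → El → Set ℓ where
    ≼-refl : ∀ {x} → x ≼ x
    bottom : ∀ {x} → gad ∞ ≼ x
    top    : ∀ {x} → x ≼ gad Ω
    one≼   : gad 𝟏′ ≼ gad Ω′
    cop≼   : ∀ {X b} → bit (cop X) b ≼ gad Ω′
    star≼  : ∀ {X} → star X ≼ gad Ω″
    bit≼   : ∀ {X} → bit X false ≼ bit X true

  private
    copy≼ : ∀ x → act copy x ≼ gad Ω′
    copy≼ (gad 𝟏)  = one≼
    copy≼ (gad α)  = bottom
    copy≼ (gad β₁) = bottom
    copy≼ (gad β₂) = bottom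
    copy≼ (gad Ω)  = ≼-refl
    copy≼ (gad ∞)  = bottom
    copy≼ (gad 𝟏′) = ≼-refl
    copy≼ (gad Ω′) = ≼-refl
    copy≼ (gad Ω″) = ≼-refl
    copy≼ (bit X b) = cop≼
    copy≼ (star X)  = ≼-refl

    name≼ : ∀ x → act name x ≼ gad Ω″
    name≼ (gad 𝟏)  = ≼-refl
    name≼ (gad α)  = bottom
    name≼ (gad β₁) = bottom
    name≼ (gad β₂) = bottom
    name≼ (gad Ω)  = ≼-refl
    name≼ (gad ∞)  = bottom
    name≼ (gad 𝟏′) = ≼-refl
    name≼ (gad Ω′) = ≼-refl
    name≼ (gad Ω″) = ≼-refl
    name≼ (bit X b) = star≼
    name≼ (star X)  = ≼-refl

  act-truth : ∀ x → act truth x ≡ gad 𝟏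
  act-truth (gad _)   = refl
  act-truth (bit _ _) = refl
  act-truth (star _)  = refl

  act-mono : ∀ f {x y} → x ≼ y → act f x ≼ act f y
  act-mono f            ≼-refl = ≼-refl
  act-mono truth        {x} {y} _ =
    subst (act truth x ≼_) (trans (act-truth x) (sym (act-truth y))) ≼-refl
  act-mono copy         bottom = bottom
  act-mono name         bottom = bottom
  act-mono restore      bottom = bottom
  act-mono (turn two)   bottom = bottom
  act-mono (turn three) bottom = bottom
  act-mono (probe k)    bottom = bottom
  act-mono copy         (top {x}) = copy≼ x
  act-mono name         (top {x}) = name≼ x
  act-mono restore      top = top
  act-mono (turn two)   top = top
  act-mono (turn three) top = top
  act-mono (probe k)    top = top
  act-mono copy         one≼ = ≼-refl
  act-mono name         one≼ = ≼-refl
  act-mono restore      one≼ = top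
  act-mono (turn two)   one≼ = one≼
  act-mono (turn three) one≼ = one≼
  act-mono (probe k)    one≼ = top
  act-mono copy         cop≼ = cop≼
  act-mono name         cop≼ = star≼
  act-mono restore      cop≼ = top
  act-mono (turn two)   cop≼ = cop≼
  act-mono (turn three) cop≼ = cop≼
  act-mono (probe k)    cop≼ = top
  act-mono copy         star≼ = ≼-refl
  act-mono name         star≼ = ≼-refl
  act-mono restore      star≼ = top
  act-mono (turn two)   star≼ = top
  act-mono (turn three) star≼ = top
  act-mono (probe k)    star≼ = top
  act-mono copy         bit≼ = bit≼
  act-mono name         bit≼ = ≼-refl
  act-mono restore      bit≼ = ≼-refl
  act-mono (turn two)   (bit≼ {tag _}) = ≼-refl
  act-mono (turn two)   (bit≼ {cop _}) = ≼-refl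
  act-mono (turn three) (bit≼ {tag _}) = ≼-refl
  act-mono (turn three) (bit≼ {cop _}) = ≼-refl
  act-mono (probe k)    (bit≼ {tag _}) = ≼-refl
  act-mono (probe k)    (bit≼ {cop _}) = bit≼

  D-mono : ∀ {i} E {x y} → x ≼ y → D i E x → D i E y
  D-mono E        ≼-refl d = d
  D-mono E        bottom ()
  D-mono E        top    _ = _
  D-mono E        one≼   ()
  D-mono (just _) star≼  d = _
  D-mono E        (bit≼ {tag _}) _ = _

  run-mono : ∀ {i} E w {x y} → x ≼ y → D i E (run 𝔹 w x) → D i E (run 𝔹 w y)
  run-mono E []      p = D-mono E p
  run-mono E (f ∷ w) p = run-mono E w (act-mono f p)

  -- The turns of order two increase under every foreign letter, those of order three decrease.
  data Foreign : Order → USym → Set ℓ where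
    turn₃   : Foreign two (turn three)
    turn₂   : Foreign three (turn two)
    restore : ∀ {o} → Foreign o restore
    probe   : ∀ {o} k → Foreign o (probe k)

  foreign-two : ∀ {f} → Foreign two f → ∀ x → act f x ≼ act f (act (turn two) (act (turn two) x))
  foreign-two turn₃ (gad 𝟏)  = ≼-refl
  foreign-two turn₃ (gad α)  = bottom
  foreign-two turn₃ (gad β₁) = top
  foreign-two turn₃ (gad β₂) = top
  foreign-two turn₃ (gad Ω)  = top
  foreign-two turn₃ (gad ∞)  = bottom
  foreign-two turn₃ (gad 𝟏′) = ≼-refl
  foreign-two turn₃ (gad Ω′) = ≼-refl
  foreign-two turn₃ (gad Ω″) = top
  foreign-two turn₃ (bit (tag _) _) = top
  foreign-two turn₃ (bit (cop _) _) = ≼-refl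
  foreign-two turn₃ (star _) = top
  foreign-two restore (gad 𝟏)  = top
  foreign-two restore (gad α)  = bottom
  foreign-two restore (gad β₁) = top
  foreign-two restore (gad β₂) = top
  foreign-two restore (gad Ω)  = top
  foreign-two restore (gad ∞)  = bottom
  foreign-two restore (gad 𝟏′) = ≼-refl
  foreign-two restore (gad Ω′) = top
  foreign-two restore (gad Ω″) = top
  foreign-two restore (bit (tag _) _) = top
  foreign-two restore (bit (cop _) _) = top
  foreign-two restore (star _) = top
  foreign-two (probe k) (gad 𝟏)  = top
  foreign-two (probe k) (gad α)  = bottom
  foreign-two (probe k) (gad β₁) = top
  foreign-two (probe k) (gad β₂) = top
  foreign-two (probe k) (gad Ω)  = top
  foreign-two (probe k) (gad ∞)  = bottom
  foreign-two (probe k) (gad 𝟏′) = top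
  foreign-two (probe k) (gad Ω′) = top
  foreign-two (probe k) (gad Ω″) = top
  foreign-two (probe k) (bit (tag _) _) = top
  foreign-two (probe k) (bit (cop _) false) = bit≼
  foreign-two (probe k) (bit (cop _) true) = ≼-refl
  foreign-two (probe k) (star _) = top

  foreign-three : ∀ {f} → Foreign three f → ∀ x →
                  act f (act (turn three) (act (turn three) (act (turn three) x))) ≼ act f x
  foreign-three turn₂ (gad 𝟏)  = ≼-refl
  foreign-three turn₂ (gad α)  = bottom
  foreign-three turn₂ (gad β₁) = top
  foreign-three turn₂ (gad β₂) = top
  foreign-three turn₂ (gad Ω)  = top
  foreign-three turn₂ (gad ∞)  = bottom
  foreign-three turn₂ (gad 𝟏′) = ≼-refl
  foreign-three turn₂ (gad Ω′) = ≼-refl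
  foreign-three turn₂ (gad Ω″) = top
  foreign-three turn₂ (bit (tag _) _) = top
  foreign-three turn₂ (bit (cop _) _) = ≼-refl
  foreign-three turn₂ (star _) = top
  foreign-three restore (gad 𝟏)  = top
  foreign-three restore (gad α)  = bottom
  foreign-three restore (gad β₁) = top
  foreign-three restore (gad β₂) = top
  foreign-three restore (gad Ω)  = top
  foreign-three restore (gad ∞)  = bottom
  foreign-three restore (gad 𝟏′) = ≼-refl
  foreign-three restore (gad Ω′) = top
  foreign-three restore (gad Ω″) = top
  foreign-three restore (bit (tag _) _) = top
  foreign-three restore (bit (cop _) _) = top
  foreign-three restore (star _) = top
  foreign-three (probe k) (gad 𝟏)  = top
  foreign-three (probe k) (gad α)  = bottom
  foreign-three (probe k) (gad β₁) = top
  foreign-three (probe k) (gad β₂) = top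
  foreign-three (probe k) (gad Ω)  = top
  foreign-three (probe k) (gad ∞)  = bottom
  foreign-three (probe k) (gad 𝟏′) = top
  foreign-three (probe k) (gad Ω′) = top
  foreign-three (probe k) (gad Ω″) = top
  foreign-three (probe k) (bit (tag _) _) = top
  foreign-three (probe k) (bit (cop _) false) = ≼-refl
  foreign-three (probe k) (bit (cop _) true) = bit≼
  foreign-three (probe k) (star _) = top

  foreign-α : ∀ {f} → Foreign two f → act f (gad α) ≡ gad ∞
  foreign-α turn₃     = refl
  foreign-α restore   = refl
  foreign-α (probe k) = refl

  foreign-β : ∀ {f} → Foreign three f → act f (gad β₁) ≡ gad Ω
  foreign-β turn₂     = refl
  foreign-β restore   = refl
  foreign-β (probe k) = refl

  -- The round trip through `copy` and `restore` may change a designated element, for instance a tag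
  -- into `Ω`, but no foreign letter notices.
  foreign-restore : ∀ {o f i} E → Foreign o f → ∀ x → D i E x →
                    act f (act restore (act copy x)) ≡ act f x
  foreign-restore E F (gad 𝟏) d = refl
  foreign-restore E F (gad Ω) d = refl
  foreign-restore (just _) turn₃     (gad Ω″) d = refl
  foreign-restore (just _) turn₂     (gad Ω″) d = refl
  foreign-restore (just _) restore   (gad Ω″) d = refl
  foreign-restore (just _) (probe k) (gad Ω″) d = refl
  foreign-restore E turn₃     (bit (tag _) _) d = refl
  foreign-restore E turn₂     (bit (tag _) _) d = refl
  foreign-restore E restore   (bit (tag _) _) d = refl
  foreign-restore E (probe k) (bit (tag _) _) d = refl
  foreign-restore E turn₃     (star _) d = refl
  foreign-restore E turn₂     (star _) d = refl
  foreign-restore E restore   (star _) d = refl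
  foreign-restore E (probe k) (star _) d = refl

  D-turn₂ : ∀ {i} E x → D i E x → D i E (act (turn two) (act (turn two) x))
  D-turn₂ E (gad 𝟏) d = _
  D-turn₂ E (gad Ω) d = _
  D-turn₂ (just _) (gad Ω″) d = _
  D-turn₂ E (bit (tag _) _) d = _
  D-turn₂ E (star _) d = _

  D-turn₃ : ∀ {i} E x → D i E x → D i E (act (turn three) (act (turn three) (act (turn three) x)))
  D-turn₃ E (gad 𝟏) d = _
  D-turn₃ E (gad Ω) d = _
  D-turn₃ (just _) (gad Ω″) d = _
  D-turn₃ E (bit (tag _) _) d = _
  D-turn₃ E (star _) d = _

  ¬D-copy : ∀ {i} E x → ¬ D i E (act copy x)
  ¬D-copy E (gad 𝟏) ()
  ¬D-copy E (gad α) ()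
  ¬D-copy E (gad β₁) ()
  ¬D-copy E (gad β₂) ()
  ¬D-copy E (gad Ω) ()
  ¬D-copy E (gad ∞) ()
  ¬D-copy E (gad 𝟏′) ()
  ¬D-copy E (gad Ω′) ()
  ¬D-copy E (gad Ω″) ()
  ¬D-copy E (star _) ()

  Word : Set ℓ
  Word = List USym

  private
    val : ∀ {a} {A : Set a} → A → A → UVar → A
    val x y (arg _)       = x
    val x y (num zero)    = x
    val x y (num (suc _)) = y

  module UpperFilter (C : Algebra upperSig ℓ) {H : Pred (Carrier C) ℓ} (fil : IsFilter upper C H) where

    -- Carries a rule verified in `𝔹` over to an arbitrary filter. The premises speak of `x`; the
    -- conclusion speaks of `x` if `n` is zero and of the unrelated `y` otherwise.
    infer : (ps : List Word) (q : Word) (n : ℕ) →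
            (∀ i E x y → (∀ p → p ∈ˡ ps → D i E (run 𝔹 p x)) → D i E (run 𝔹 q (val x y (num n)))) →
            ∀ x y → (∀ p → p ∈ˡ ps → H (run C p x)) → H (run C q (val x y (num n)))
    infer ps q n sound x y hs =
      subst H (eval-runF C v q (var (num n)))
        (fil (λ ψ → Σ[ p ∈ Word ] (p ∈ˡ ps × ψ ≡ runF p (var (num 0)))) (runF q (var (num n))) v
          (λ i E w h → subst (D i E) (sym (eval-runF 𝔹 w q (var (num n))))
            (subst (λ z → D i E (run 𝔹 q z)) (val-num w n)
              (sound i E (w (num 0)) (w (num n)) λ p p∈ →
                subst (D i E) (eval-runF 𝔹 w p (var (num 0))) (h _ (p , p∈ , refl)))))
          λ { _ (p , p∈ , refl) → subst H (sym (eval-runF C v p (var (num 0)))) (hs p p∈) })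
      where
      v = val x y
      val-num : (w : UVar → El) → ∀ n → val (w (num 0)) (w (num n)) (num n) ≡ w (num n)
      val-num w zero    = refl
      val-num w (suc n) = refl

    axiom : (q : Word) → (∀ i E x → D i E (run 𝔹 q x)) → ∀ x → H (run C q x)
    axiom q sound x = infer [] q 0 (λ i E x _ _ → sound i E x) x x λ _ ()

    rule : (p q : Word) → (∀ i E x → D i E (run 𝔹 p x) → D i E (run 𝔹 q x)) →
           ∀ x → H (run C p x) → H (run C q x)
    rule p q sound x h =
      infer (p ∷ []) q 0 (λ i E x _ hs → sound i E x (hs p (here refl))) x x λ { _ (here refl) → h }

    rule₂ : (p p′ q : Word) → (∀ i E x → D i E (run 𝔹 p x) → D i E (run 𝔹 p′ x) → D i E (run 𝔹 q x)) →
            ∀ x → H (run C p x) → H (run C p′ x) → H (run C q x)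
    rule₂ p p′ q sound x h h′ =
      infer (p ∷ p′ ∷ []) q 0
        (λ i E x _ hs → sound i E x (hs p (here refl)) (hs p′ (there (here refl)))) x x
        λ { _ (here refl) → h ; _ (there (here refl)) → h′ }

    explode : (p q : Word) → (∀ i E x y → D i E (run 𝔹 p x) → D i E (run 𝔹 q y)) →
              ∀ x y → H (run C p x) → H (run C q y)
    explode p q sound x y h =
      infer (p ∷ []) q 1 (λ i E x y hs → sound i E x y (hs p (here refl))) x y λ { _ (here refl) → h }

    private
      -- Replaces function extensionality: the operations of `𝔹` inspect only `as zero`, so the two
      -- formulas have equal values there and are interderivable in `upper` under every word.
      op-app : ∀ w f (as : Fin 1 → Carrier C) →
               (H (run C w (op C f as)) → H (run C w (app C f (as zero)))) ×
               (H (run C w (app C f (as zero))) → H (run C w (op C f as)))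
      op-app w f as = swap φ φ′ (λ w → refl) , swap φ′ φ (λ w → refl)
        where
        φ φ′ : UForm
        φ  = node f (λ i → var (arg i))
        φ′ = unary f (var (arg zero))
        v : UVar → Carrier C
        v (arg i) = as i
        v (num _) = as zero
        swap : ∀ χ χ′ → (∀ w → eval 𝔹 w χ ≡ eval 𝔹 w χ′) →
               H (run C w (eval C v χ)) → H (run C w (eval C v χ′))
        swap χ χ′ same h =
          subst H (eval-runF C v w χ′)
            (fil (_≡ runF w χ) (runF w χ′) v
              (λ i E u d → subst (D i E)
                (trans (eval-runF 𝔹 u w χ)
                  (trans (cong (run 𝔹 w) (same u)) (sym (eval-runF 𝔹 u w χ′)))) (d _ refl))
              λ { _ refl → subst H (sym (eval-runF C v w χ)) h })

    op⇒app : ∀ w f as → H (run C w (op C f as)) → H (run C w (app C f (as zero)))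
    op⇒app w f as = proj₁ (op-app w f as)

    app⇒op : ∀ w f as → H (run C w (app C f (as zero))) → H (run C w (op C f as))
    app⇒op w f as = proj₂ (op-app w f as)

  -- Interpreting the cyclic logics in the upper bounds

  embed : Order → CyclicSym ℓ → USym
  embed o truth = truth
  embed o turn  = turn o
  embed o copy  = copy
  embed o name  = name

  embedding : ∀ o → Translation (cyclicSig ℓ) upperSig
  embedding o f = unary (embed o f) (var zero)

  data Native (o : Order) : USym → Set ℓ where
    embedded : ∀ f → Native o (embed o f)
    foreign  : ∀ {f} → Foreign o f → Native o f

  native? : ∀ o f → Native o f
  native? o     truth        = embedded truth
  native? o     copy         = embedded copy
  native? o     name         = embedded name
  native? o     restore      = foreign restore
  native? two   (turn two)   = embedded turn
  native? two   (turn three) = foreign turn₃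
  native? three (turn two)   = foreign turn₂
  native? three (turn three) = embedded turn
  native? o     (probe k)    = foreign (probe k)

  module Lower (C : Algebra upperSig ℓ) where

    restricts : ∀ o {H : Pred (Carrier C) ℓ} → IsFilter upper C H →
                CyclicFilter ℓ o (C ^[ embedding o ]) H
    restricts two {H} fil = record
      { has-truth = axiom (truth ∷ []) (λ i E x → subst (D i E) (sym (act-truth x)) tt)
      ; has-turn  = rule [] (turn two ∷ turn two ∷ []) (λ i E → D-turn₂ E)
      ; explodes  = explode (truth ∷ turn two ∷ turn two ∷ turn two ∷ []) []
          λ i E x y d → ⊥ᵖ-elim
            (subst (D i E ∘ run 𝔹 (turn two ∷ turn two ∷ turn two ∷ [])) (act-truth x) d)
      }
      where open UpperFilter C {H} fil
    restricts three {H} fil = record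
      { has-truth = axiom (truth ∷ []) (λ i E x → subst (D i E) (sym (act-truth x)) tt)
      ; has-turn  = rule [] (turn three ∷ turn three ∷ turn three ∷ []) (λ i E → D-turn₃ E)
      ; explodes  = explode (truth ∷ turn three ∷ turn three ∷ turn three ∷ turn three ∷ []) []
          λ i E x y d → ⊥ᵖ-elim
            (subst (D i E ∘ run 𝔹 (turn three ∷ turn three ∷ turn three ∷ turn three ∷ []))
              (act-truth x) d)
      }
      where open UpperFilter C {H} fil

    module _ {o : Order} {F : Pred (Carrier C) ℓ} (filF : IsFilter upper C F)
             {θ : Rel (Carrier C) ℓ} (θ-cong : IsCongruence (cyclic ℓ o) (C ^[ embedding o ]) θ)
             (θ-compat : ∀ G → IsFilter (cyclic ℓ o) (C ^[ embedding o ]) G → F ⊆ G →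
                         Compatible (cyclic ℓ o) (C ^[ embedding o ]) θ G) where

      private
        θ-app : ∀ f {a b} → θ a b → θ (app C (embed o f) a) (app C (embed o f) b)
        θ-app f p = proj₂ θ-cong f _ _ (λ _ → p)

        θ-sym : ∀ {a b} → θ a b → θ b a
        θ-sym = IsEquivalence.sym (proj₁ θ-cong)

        compat : ∀ {G} → CyclicFilter ℓ o (C ^[ embedding o ]) G → F ⊆ G → ∀ {a b} → θ a b → G a → G b
        compat g F⊆G p = θ-compat _ (fromCyclicFilter ℓ _ g) F⊆G _ _ p

        θ-F : ∀ {a b} → θ a b → F a → F b
        θ-F = compat {F} (restricts o filF) id

      module _ {H : Pred (Carrier C) ℓ} (filH : IsFilter upper C H) (F⊆H : F ⊆ H) where

        open UpperFilter C {H} filH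

        -- Tested on the cyclic filter F ∪ {x | w (f x) ∈ H} for order two and on
        -- F ∪ {x | w (f x) ∈ H → w (f b) ∈ H} for order three.
        foreign-step-weak : ∀ f w → Foreign o f → ∀ {a b} → θ a b →
                            H (run C (f ∷ w) a) → H (run C (f ∷ w) b) ⊎ F b
        foreign-step-weak f w φ {a} {b} p h = go o refl φ
          where
          module F = CyclicFilter (restricts o {F} filF)
          go : ∀ o′ → o′ ≡ o → Foreign o′ f → H (run C (f ∷ w) b) ⊎ F b
          go two refl φ = compat {λ x → H (run C (f ∷ w) x) ⊎ F x} (record
            { has-truth = λ x → inj₂ (F.has-truth x)
            ; has-turn  = λ x → [ inj₁ ∘ rule (f ∷ w) (turn two ∷ turn two ∷ f ∷ w)
                                           (λ i E x → run-mono E w (foreign-two φ x)) x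
                                , inj₂ ∘ F.has-turn x ]
            ; explodes  = λ x y →
                [ inj₁ ∘ explode (truth ∷ turn two ∷ turn two ∷ turn two ∷ f ∷ w) (f ∷ w)
                           (λ i E x y → run-mono E w
                             (subst (λ z → act f (run 𝔹 (turn two ∷ turn two ∷ turn two ∷ []) z) ≼ act f y)
                               (sym (act-truth x))
                               (subst (_≼ act f y) (sym (foreign-α φ)) bottom))) x y
                , inj₂ ∘ F.explodes x y ]
            }) inj₂ p (inj₁ h)
          go three refl φ = [ (λ k → inj₁ (k h)) , inj₂ ∘ θ-F p ]
            (compat {λ x → (H (run C (f ∷ w) x) → H (run C (f ∷ w) b)) ⊎ F x} (record
            { has-truth = λ x → inj₂ (F.has-truth x)
            ; has-turn  = λ x → [ (λ k → inj₁ (k ∘ rule (turn three ∷ turn three ∷ turn three ∷ f ∷ w) (f ∷ w)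
                                           (λ i E x → run-mono E w (foreign-three φ x)) x))
                                , inj₂ ∘ F.has-turn x ]
            ; explodes  = λ x y →
                [ (λ k → inj₁ (k ∘ explode (f ∷ w)
                           (truth ∷ turn three ∷ turn three ∷ turn three ∷ turn three ∷ f ∷ w)
                           (λ i E y x → run-mono E w
                             (subst (λ z → act f y ≼ act f (run 𝔹 (turn three ∷ turn three ∷ turn three ∷ turn three ∷ []) z))
                               (sym (act-truth x))
                               (subst (act f y ≼_) (sym (foreign-β φ)) top))) y x))
                , inj₂ ∘ F.explodes x y ]
            }) inj₂ (θ-sym p) (inj₁ id))

        -- For designated arguments the copies, which are never designated, are compared instead.
        foreign-step : ∀ f w → Foreign o f → ∀ {a b} → θ a b →
                       H (run C (f ∷ w) a) → H (run C (f ∷ w) b)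
        foreign-step f w φ {a} {b} p h with foreign-step-weak f w φ p h
        ... | inj₁ h′ = h′
        ... | inj₂ Fb with foreign-step-weak restore (f ∷ w) restore (θ-app copy p)
                             (rule₂ [] (f ∷ w) (copy ∷ restore ∷ f ∷ w)
                               (λ i E x d → subst (D i E ∘ run 𝔹 w) (sym (foreign-restore E φ x d)))
                               a (F⊆H (θ-F (θ-sym p) Fb)) h)
        ...   | inj₁ h′ = rule₂ [] (copy ∷ restore ∷ f ∷ w) (f ∷ w)
                            (λ i E x d → subst (D i E ∘ run 𝔹 w) (foreign-restore E φ x d))
                            b (F⊆H Fb) h′
        ...   | inj₂ Fc = explode (copy ∷ []) (f ∷ w) (λ i E x _ d → ⊥-elim (¬D-copy E x d)) b b (F⊆H Fc)

        -- The congruence absorbs embedded letters; the first foreign letter hands the whole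
        -- remaining word to `foreign-step`.
        run-step : ∀ w {a b} → θ a b → H (run C w a) → H (run C w b)
        run-step []      p h = compat {H} (restricts o filH) F⊆H p h
        run-step (f ∷ w) p h with native? o f
        ... | embedded f′ = run-step w (θ-app f′ p) h
        ... | foreign φ   = foreign-step f w φ p h

      data Generated : Rel (Carrier C) ℓ where
        base  : ∀ {a b} → θ a b → Generated a b
        refl′ : ∀ {a} → Generated a a
        sym′  : ∀ {a b} → Generated a b → Generated b a
        tran′ : ∀ {a b c} → Generated a b → Generated b c → Generated a c
        cong′ : ∀ f as bs → Generated (as zero) (bs zero) → Generated (op C f as) (op C f bs)

      -- All words `w` have to be treated at once, because `cong′` prepends its letter to the word.
      generated-compat : ∀ {H} → IsFilter upper C H → F ⊆ H → ∀ {a b} → Generated a b → ∀ w →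
                         (H (run C w a) → H (run C w b)) × (H (run C w b) → H (run C w a))
      generated-compat filH F⊆H (base p) w = run-step filH F⊆H w p , run-step filH F⊆H w (θ-sym p)
      generated-compat filH F⊆H refl′ w = id , id
      generated-compat filH F⊆H (sym′ g) w with generated-compat filH F⊆H g w
      ... | to , from = from , to
      generated-compat filH F⊆H (tran′ g g′) w with generated-compat filH F⊆H g w | generated-compat filH F⊆H g′ w
      ... | to , from | to′ , from′ = to′ ∘ to , from ∘ from′
      generated-compat {H} filH F⊆H (cong′ f as bs g) w with generated-compat filH F⊆H g (f ∷ w)
      ... | to , from = app⇒op w f bs ∘ to ∘ op⇒app w f as , app⇒op w f as ∘ from ∘ op⇒app w f bs
        where open UpperFilter C {H} filH

      generated-suszko : ∀ {a b} → θ a b → Suszko upper C F a b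
      generated-suszko p = Generated
        , ( record { refl = refl′ ; sym = sym′ ; trans = tran′ }
          , (λ f as bs h → cong′ f as bs (h zero)))
        , (λ G filG F⊆G a b g → proj₁ (generated-compat filG F⊆G g []))
        , base p

  cyclic≤upper : ∀ o → cyclic ℓ o ≤ᴵ upper
  cyclic≤upper o = embedding o , λ C F (filF , reduced) →
    fromCyclicFilter ℓ _ (Lower.restricts C o {F} filF) ,
    λ a b (θ , θ-cong , θ-compat , p) →
      reduced a b (Lower.generated-suszko C {F = F} filF θ-cong θ-compat p)

  -- The models of the upper bounds are reduced

  D-filter : ∀ i E → IsFilter upper 𝔹 (D i E)
  D-filter i E Γ φ v d h = d i E v h

  D-⊆ : ∀ {i} E → D i nothing ⊆ D i E
  D-⊆ E {gad 𝟏} d = _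
  D-⊆ E {gad Ω} d = _
  D-⊆ E {bit (tag _) false} d = d
  D-⊆ E {bit (tag _) true} d = _

  -- Decides whether `act (probe i) x` lies in `D i nothing`. The answer is the same for every `i`:
  -- probe `i` moves a copied bit to `tag i`, the one class whose bits this set distinguishes.
  probed : El → Bool
  probed (gad α)         = false
  probed (gad ∞)         = false
  probed (gad _)         = true
  probed (bit (tag _) _) = true
  probed (bit (cop _) b) = b
  probed (star _)        = true

  turned : El → Bool
  turned (gad 𝟏)         = false
  turned (gad ∞)         = false
  turned (gad 𝟏′)        = false
  turned (gad Ω′)        = false
  turned (gad _)         = true
  turned (bit (tag _) _) = true
  turned (bit (cop _) _) = false
  turned (star _)        = true

  T-probed : ∀ i x → T (probed x) → D i nothing (act (probe i) x)
  T-probed i (gad 𝟏) _ = _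
  T-probed i (gad β₁) _ = _
  T-probed i (gad β₂) _ = _
  T-probed i (gad Ω) _ = _
  T-probed i (gad 𝟏′) _ = _
  T-probed i (gad Ω′) _ = _
  T-probed i (gad Ω″) _ = _
  T-probed i (bit (tag _) _) _ = _
  T-probed i (bit (cop _) true) _ = _
  T-probed i (star _) _ = _

  probed-T : ∀ i x → D i nothing (act (probe i) x) → T (probed x)
  probed-T i (gad 𝟏) _ = _
  probed-T i (gad β₁) _ = _
  probed-T i (gad β₂) _ = _
  probed-T i (gad Ω) _ = _
  probed-T i (gad 𝟏′) _ = _
  probed-T i (gad Ω′) _ = _
  probed-T i (gad Ω″) _ = _
  probed-T i (bit (tag _) _) _ = _
  probed-T i (bit (cop _) true) _ = _
  probed-T i (bit (cop _) false) d = d refl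
  probed-T i (star _) _ = _

  T-turned : ∀ i x → T (turned x) → D i nothing (act (turn two) x)
  T-turned i (gad α) _ = _
  T-turned i (gad β₁) _ = _
  T-turned i (gad β₂) _ = _
  T-turned i (gad Ω) _ = _
  T-turned i (gad Ω″) _ = _
  T-turned i (bit (tag _) _) _ = _
  T-turned i (star _) _ = _

  turned-T : ∀ i x → D i nothing (act (turn two) x) → T (turned x)
  turned-T i (gad α) _ = _
  turned-T i (gad β₁) _ = _
  turned-T i (gad β₂) _ = _
  turned-T i (gad Ω) _ = _
  turned-T i (gad Ω″) _ = _
  turned-T i (bit (tag _) _) _ = _
  turned-T i (star _) _ = _

  data Shape : Set where
    exactly       : Gad → Shape
    tagged copied : Bool → Shape
    other         : Shape

  data Other : El → Set ℓ where
    Ω    : Other (gad Ω)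
    Ω″   : Other (gad Ω″)
    star : ∀ X → Other (star X)

  Matches : Shape → El → Set ℓ
  Matches (exactly g) x = x ≡ gad g
  Matches (tagged b)  x = ∃ λ j → x ≡ bit (tag j) b
  Matches (copied b)  x = ∃ λ X → x ≡ bit (cop X) b
  Matches other       x = Other x

  tests : List Word
  tests = (copy ∷ turn two ∷ []) ∷ [] ∷ (turn two ∷ []) ∷ (turn three ∷ turn two ∷ [])
        ∷ (copy ∷ turn three ∷ []) ∷ (turn three ∷ []) ∷ (copy ∷ []) ∷ (restore ∷ turn two ∷ []) ∷ []

  results : El → List Bool
  results x = map (λ w → probed (run 𝔹 w x)) tests

  -- A decision tree on the probed results. They agree on `Ω′`, `Ω`, `Ω″` and the stars; the second
  -- argument, supplied by `turned`, singles out `Ω′`.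
  decode : List Bool → Bool → Shape
  decode (false ∷ false ∷ true  ∷ _) _ = exactly α
  decode (false ∷ false ∷ false ∷ _) _ = exactly ∞
  decode (false ∷ true ∷ _ ∷ true  ∷ _) _ = exactly β₁
  decode (false ∷ true ∷ _ ∷ false ∷ _) _ = exactly β₂
  decode (true ∷ _ ∷ _ ∷ _ ∷ false ∷ true  ∷ b ∷ _) _ = tagged b
  decode (true ∷ _ ∷ _ ∷ _ ∷ false ∷ false ∷ b ∷ _) _ = copied b
  decode (true ∷ _ ∷ false ∷ _ ∷ true ∷ _) _ = exactly 𝟏
  decode (true ∷ _ ∷ true ∷ _ ∷ true ∷ _ ∷ _ ∷ false ∷ _) _ = exactly 𝟏′
  decode (true ∷ _ ∷ true ∷ _ ∷ true ∷ _ ∷ _ ∷ true ∷ _) false = exactly Ω′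
  decode _ _ = other

  shape : El → Shape
  shape x = decode (results x) (turned x)

  matches-shape : ∀ x → Matches (shape x) x
  matches-shape (gad 𝟏)  = refl
  matches-shape (gad α)  = refl
  matches-shape (gad β₁) = refl
  matches-shape (gad β₂) = refl
  matches-shape (gad Ω)  = Ω
  matches-shape (gad ∞)  = refl
  matches-shape (gad 𝟏′) = refl
  matches-shape (gad Ω′) = refl
  matches-shape (gad Ω″) = Ω″
  matches-shape (bit (tag j) true)  = j , refl
  matches-shape (bit (tag j) false) = j , refl
  matches-shape (bit (cop X) true)  = X , refl
  matches-shape (bit (cop X) false) = X , refl
  matches-shape (star X) = star X

  module _ (i : I) {θ : Rel El ℓ} (θ-cong : IsCongruence upper 𝔹 θ)
           (θ-compat : ∀ G → IsFilter upper 𝔹 G → D i nothing ⊆ G → Compatible upper 𝔹 θ G) where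

    private
      θ-sym : ∀ {x y} → θ x y → θ y x
      θ-sym = IsEquivalence.sym (proj₁ θ-cong)

      θ-run : ∀ w {x y} → θ x y → θ (run 𝔹 w x) (run 𝔹 w y)
      θ-run []      p = p
      θ-run (f ∷ w) p = θ-run w (proj₂ θ-cong f _ _ (λ _ → p))

      θ-D : ∀ E {x y} → θ x y → D i E x → D i E y
      θ-D E p = θ-compat _ (D-filter i E) (D-⊆ E) _ _ p

      θ-probed : ∀ {x y} → θ x y → probed x ≡ probed y
      θ-probed p = T-≡ (go p) (go (θ-sym p))
        where
        go : ∀ {x y} → θ x y → T (probed x) → T (probed y)
        go {x} {y} p t = probed-T i y (θ-D nothing (θ-run (probe i ∷ []) p) (T-probed i x t))

      θ-turned : ∀ {x y} → θ x y → turned x ≡ turned y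
      θ-turned p = T-≡ (go p) (go (θ-sym p))
        where
        go : ∀ {x y} → θ x y → T (turned x) → T (turned y)
        go {x} {y} p t = turned-T i y (θ-D nothing (θ-run (turn two ∷ []) p) (T-turned i x t))

      θ-shape : ∀ {x y} → θ x y → shape x ≡ shape y
      θ-shape {x} {y} p =
        trans (cong (λ rs → decode rs (turned x)) (map-cong (λ w → θ-probed (θ-run w p)) tests))
              (cong (decode (results y)) (θ-turned p))

      θ-star : ∀ {X Y} → θ (star X) (star Y) → X ≡ Y
      θ-star {X} p with refl ← θ-D (just X) p refl = refl

      θ-other : ∀ {x y} → θ x y → Other x → Other y → x ≡ y
      θ-other p Ω Ω = refl
      θ-other p Ω Ω″ = ⊥ᵖ-elim (θ-D nothing p _)
      θ-other p Ω (star X) with () ← θ-D nothing p _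
      θ-other p Ω″ Ω = ⊥ᵖ-elim (θ-D nothing (θ-sym p) _)
      θ-other p Ω″ Ω″ = refl
      -- Since `cop X` differs from `X`, the set `D i (just (cop X))` contains `Ω″` but not
      -- `star X`.
      θ-other p Ω″ (star X) with () ← θ-D (just (cop X)) p _
      θ-other p (star X) Ω with () ← θ-D nothing (θ-sym p) _
      θ-other p (star X) Ω″ with () ← θ-D (just (cop X)) (θ-sym p) _
      θ-other p (star X) (star Y) = cong star (θ-star p)

      θ-matches : ∀ s {x y} → θ x y → Matches s x → Matches s y → x ≡ y
      θ-matches (exactly g) p refl refl = refl
      θ-matches (tagged b) p (j , refl) (k , refl) =
        cong (λ X → bit X b) (θ-star (θ-run (name ∷ []) p))
      θ-matches (copied b) p (X , refl) (Y , refl) =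
        cong (λ X → bit X b) (θ-star (θ-run (name ∷ []) p))
      θ-matches other p m m′ = θ-other p m m′

    separated : ∀ {x y} → θ x y → x ≡ y
    separated {x} {y} p = θ-matches (shape x) p (matches-shape x)
      (subst (λ s → Matches s y) (sym (θ-shape p)) (matches-shape y))

  inMod-D : ∀ i → InModS upper 𝔹 (D i nothing)
  inMod-D i = D-filter i nothing , λ x y (θ , θ-cong , θ-compat , p) → separated i θ-cong θ-compat p

-- Bounds that miss a probe

_≡ᵇ_ : Bool → Bool → Bool
false ≡ᵇ c = not c
true  ≡ᵇ c = c

congruence-eval : ∀ {ℓ} (𝓛 : Logic ℓ) (A : Algebra (lang 𝓛) ℓ) {θ : Rel (Carrier A) ℓ} →
                  IsCongruence 𝓛 A θ → ∀ {ℓ′} {V : Set ℓ′} (v v′ : V → Carrier A) →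
                  (∀ x → θ (v x) (v′ x)) → ∀ t → θ (eval A v t) (eval A v′ t)
congruence-eval 𝓛 A c v v′ p (var x)     = p x
congruence-eval 𝓛 A c v v′ p (node f ts) = proj₂ c f _ _ (λ k → congruence-eval 𝓛 A c v v′ p (ts k))

module _ {ℓ : Level} {I : Set ℓ} where

  𝔸 : Algebra (upperSig I) ℓ
  𝔸 = record
    { Carrier = Lift ℓ Pt
    ; op      = λ f as → lift (actP (letter I f) (lower (as zero)))
    }

  spell : Word I → List Letter
  spell = map (letter I)

  run-𝔸 : ∀ w p → run 𝔸 w (lift p) ≡ lift (runP (spell w) p)
  run-𝔸 []      p = refl
  run-𝔸 (f ∷ w) p = run-𝔸 w (actP (letter I f) p)

  run-𝔹-gad : ∀ w x → run (𝔹 I) w (gad x) ≡ gad (runG (spell w) x)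
  run-𝔹-gad []      x = refl
  run-𝔹-gad (f ∷ w) x = run-𝔹-gad w (actG (letter I f) x)

  -- The innermost letter comes first, in the order in which `run` applies them.
  parse : ∀ {ℓ′} {V : Set ℓ′} → Term (upperSig I) V → Word I × V
  parse (var x)     = [] , x
  parse (node f ts) = let w , x = parse (ts zero) in w ++ f ∷ [] , x

  Unary : Algebra (upperSig I) ℓ → Set ℓ
  Unary A = ∀ f as → op A f as ≡ app A f (as zero)

  eval-parse : ∀ {ℓ′} {V : Set ℓ′} (A : Algebra (upperSig I) ℓ) → Unary A → (v : V → Carrier A) → ∀ t →
               eval A v t ≡ run A (proj₁ (parse t)) (v (proj₂ (parse t)))
  eval-parse A u v (var x)     = refl
  eval-parse A u v (node f ts) =
    trans (u f _) (trans (cong (app A f) (eval-parse A u v (ts zero)))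
      (sym (run-++ A (proj₁ (parse (ts zero))) (f ∷ []) _)))

  module Translated {L : Signature ℓ} (σ : Translation L (upperSig I)) where

    parseσ : ∀ {ℓ′} {V : Set ℓ′} → Term L V → Word I × V
    parseσ (var x)     = [] , x
    parseσ (node f ts) = let w , k = parse (σ f) ; w′ , x = parseσ (ts k) in w′ ++ w , x

    eval-parseσ : ∀ {ℓ′} {V : Set ℓ′} (A : Algebra (upperSig I) ℓ) → Unary A → (v : V → Carrier A) → ∀ t →
                  eval (A ^[ σ ]) v t ≡ run A (proj₁ (parseσ t)) (v (proj₂ (parseσ t)))
    eval-parseσ A u v (var x)     = refl
    eval-parseσ A u v (node f ts) with parse (σ f) | eval-parse A u (λ i → eval (A ^[ σ ]) v (ts i)) (σ f)
    ... | w , k | e = trans e (trans (cong (run A w) (eval-parseσ A u v (ts k)))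
                        (sym (run-++ A (proj₁ (parseσ (ts k))) w _)))

  -- A homomorphism by `φ-act`, along which filters on `𝔹` pull back to `𝔸`. Both points become
  -- designated.
  φ : Pt → El I
  φ (gad x) = gad x
  φ (pt _)  = gad Ω

  φ-act : ∀ f p → φ (actP (letter I f) p) ≡ act I f (φ p)
  φ-act f         (gad x) = refl
  φ-act truth     (pt _)  = refl
  φ-act copy      (pt _)  = refl
  φ-act name      (pt _)  = refl
  φ-act restore   (pt _)  = refl
  φ-act (probe k) (pt _)  = refl
  φ-act (turn two)   (pt _) = refl
  φ-act (turn three) (pt _) = refl

  φ-run : ∀ w p → φ (runP (spell w) p) ≡ run (𝔹 I) w (φ p)
  φ-run []      p = refl
  φ-run (f ∷ w) p = trans (φ-run w _) (cong (run (𝔹 I) w) (φ-act f p))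

  designated⇒D : ∀ i x → T (designated x) → D I i nothing (gad x)
  designated⇒D i 𝟏 _ = _
  designated⇒D i Ω _ = _

  D⇒designated : ∀ i x → D I i nothing (gad x) → T (designated x)
  D⇒designated i 𝟏 _ = _
  D⇒designated i Ω _ = _

  -- How the finite algebra sits above 𝔹: gadget elements also stand for what the unused probes
  -- produce, and the points stand for the two bits of an arbitrary copy.
  data _∣_∣_∼_ (i : I) (Z : Cls I) : Pt → El I → Set ℓ where
    same  : ∀ {x} → i ∣ Z ∣ gad x ∼ gad x
    tag∼  : ∀ {j b} → j ≢ i → i ∣ Z ∣ gad Ω ∼ bit (tag j) b
    cop∼  : ∀ {X b} → i ∣ Z ∣ gad Ω′ ∼ bit (cop X) b
    star∼ : ∀ {X} → i ∣ Z ∣ gad Ω″ ∼ star X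
    pt∼   : ∀ {b} → i ∣ Z ∣ pt b ∼ bit (cop Z) b

  Avoids : I → Word I → Set ℓ
  Avoids i = All (_≢ probe i)

  ∼-act : ∀ {i Z} f → f ≢ probe i → ∀ {p x} → i ∣ Z ∣ p ∼ x → i ∣ Z ∣ actP (letter I f) p ∼ act I f x
  ∼-act f            ne same     = same
  ∼-act truth        ne (tag∼ _) = same
  ∼-act copy         ne (tag∼ _) = cop∼
  ∼-act name         ne (tag∼ _) = star∼
  ∼-act restore      ne (tag∼ _) = same
  ∼-act (turn two)   ne (tag∼ _) = same
  ∼-act (turn three) ne (tag∼ _) = same
  ∼-act (probe k)    ne (tag∼ _) = same
  ∼-act truth        ne cop∼     = same
  ∼-act copy         ne cop∼     = cop∼
  ∼-act name         ne cop∼     = star∼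
  ∼-act restore      ne cop∼     = same
  ∼-act (turn two)   ne cop∼     = cop∼
  ∼-act (turn three) ne cop∼     = cop∼
  ∼-act (probe k)    ne cop∼     = tag∼ λ { refl → ne refl }
  ∼-act truth        ne star∼    = same
  ∼-act copy         ne star∼    = same
  ∼-act name         ne star∼    = same
  ∼-act restore      ne star∼    = same
  ∼-act (turn two)   ne star∼    = same
  ∼-act (turn three) ne star∼    = same
  ∼-act (probe k)    ne star∼    = same
  ∼-act truth        ne pt∼      = same
  ∼-act copy         ne pt∼      = cop∼
  ∼-act name         ne pt∼      = star∼
  ∼-act restore      ne pt∼      = same
  ∼-act (turn two)   ne pt∼      = pt∼
  ∼-act (turn three) ne pt∼      = pt∼
  ∼-act (probe k)    ne pt∼      = tag∼ λ { refl → ne refl }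

  ∼-run : ∀ {i Z w} → Avoids i w → ∀ {p x} → i ∣ Z ∣ p ∼ x → i ∣ Z ∣ runP (spell w) p ∼ run (𝔹 I) w x
  ∼-run []       r = r
  ∼-run (a ∷ as) r = ∼-run as (∼-act _ a r)

  section : Cls I → Pt → El I
  section Z (gad x) = gad x
  section Z (pt b)  = bit (cop Z) b

  ∼-section : ∀ {i} Z p → i ∣ Z ∣ p ∼ section Z p
  ∼-section Z (gad x) = same
  ∼-section Z (pt b)  = pt∼

  -- The classes whose two bits `D i nothing` does not distinguish. Only probe `i` leads from them
  -- to the excluded class `tag i`.
  data Soft (i : I) : Cls I → Set ℓ where
    tag : ∀ {j} → j ≢ i → Soft i (tag j)
    cop : ∀ {X} → Soft i (cop X)

  data _∣_≈_ (i : I) : El I → El I → Set ℓ where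
    same : ∀ {x} → i ∣ x ≈ x
    soft : ∀ {X b c} → Soft i X → i ∣ bit X b ≈ bit X c

  ≈-sym : ∀ {i x y} → i ∣ x ≈ y → i ∣ y ≈ x
  ≈-sym same     = same
  ≈-sym (soft s) = soft s

  ≈-trans : ∀ {i x y z} → i ∣ x ≈ y → i ∣ y ≈ z → i ∣ x ≈ z
  ≈-trans same     q        = q
  ≈-trans (soft s) same     = soft s
  ≈-trans (soft s) (soft t) = soft s

  ≈-act : ∀ {i} f → f ≢ probe i → ∀ {x y} → i ∣ x ≈ y → i ∣ act I f x ≈ act I f y
  ≈-act f            ne same           = same
  ≈-act truth        ne (soft _)       = same
  ≈-act copy         ne (soft _)       = soft cop
  ≈-act name         ne (soft _)       = same
  ≈-act restore      ne (soft _)       = same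
  ≈-act (turn two)   ne (soft (tag _)) = same
  ≈-act (turn two)   ne (soft cop)     = same
  ≈-act (turn three) ne (soft (tag _)) = same
  ≈-act (turn three) ne (soft cop)     = same
  ≈-act (probe k)    ne (soft (tag _)) = same
  ≈-act (probe k)    ne (soft cop)     = soft (tag λ { refl → ne refl })

  ≈-run : ∀ {i w} → Avoids i w → ∀ {x y} → i ∣ x ≈ y → i ∣ run (𝔹 I) w x ≈ run (𝔹 I) w y
  ≈-run []       p = p
  ≈-run (a ∷ as) p = ≈-run as (≈-act _ a p)

  -- The finite algebra refutes a bound that misses probe `i`

  module Contradiction (𝓢 : Logic ℓ) (bound : ∀ o → cyclic ℓ o ≤ᴵ 𝓢)
           (σ : Translation (lang 𝓢) (upperSig I)) (interprets : IsInterpretation 𝓢 (upper I) σ)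
           (i : I) (avoids : ∀ f → Avoids i (proj₁ (parse (σ f)))) where

    open Translated {L = lang 𝓢} σ

    private
      𝔸σ 𝔹σ : Algebra (lang 𝓢) ℓ
      𝔸σ = 𝔸 ^[ σ ]
      𝔹σ = 𝔹 I ^[ σ ]

      D₀ : Pred (El I) ℓ
      D₀ = D I i nothing

      mod𝔹 : InModS 𝓢 𝔹σ D₀
      mod𝔹 = interprets (𝔹 I) D₀ (inMod-D I i)

      spelling : ∀ {ℓ′} {V : Set ℓ′} → Term (lang 𝓢) V → List Letter
      spelling t = spell (proj₁ (parseσ t))

      head : ∀ {ℓ′} {V : Set ℓ′} → Term (lang 𝓢) V → V
      head t = proj₂ (parseσ t)

      eval𝔸 : ∀ {ℓ′} {V : Set ℓ′} (v : V → Lift ℓ Pt) t →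
              eval 𝔸σ v t ≡ lift (runP (spelling t) (lower (v (head t))))
      eval𝔸 v t = trans (eval-parseσ 𝔸 (λ _ _ → refl) v t) (run-𝔸 (proj₁ (parseσ t)) _)

      eval𝔹 : ∀ {ℓ′} {V : Set ℓ′} (v : V → El I) t → eval 𝔹σ v t ≡ run (𝔹 I) (proj₁ (parseσ t)) (v (head t))
      eval𝔹 = eval-parseσ (𝔹 I) (λ _ _ → refl)

      avoids-parseσ : ∀ {ℓ′} {V : Set ℓ′} (t : Term (lang 𝓢) V) → Avoids i (proj₁ (parseσ t))
      avoids-parseσ (var x)     = []
      avoids-parseσ (node f ts) with parse (σ f) | avoids f
      ... | w , k | a = ++⁺ (avoids-parseσ (ts k)) a

      turnTerm : Order → Term (lang 𝓢) (Fin 1)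
      turnTerm o = proj₁ (bound o) turn

    -- The reduct of `𝔹` along both translations is a model of `cyclic o`; its filter conditions,
    -- read on the gadget, are the hypotheses of `rigid`.
    turn-rigid : ∀ o → ∃ λ q → Turns o q × (∀ p → runP (spelling (turnTerm o)) p ≡ runP (pureWord q) p)
    turn-rigid o = rigid o w closed c dc escapes
      where
      τ = proj₁ (bound o)
      w = spelling (turnTerm o)
      c = runG (spelling (τ truth)) 𝟏
      B = 𝔹σ ^[ τ ]
      open CyclicFilter (toCyclicFilter ℓ {o} B {D₀} (proj₁ (proj₂ (bound o) 𝔹σ D₀ mod𝔹)))
      app-gad : ∀ f x → app B f (gad x) ≡ gad (runG (spelling (τ f)) x)
      app-gad f x = trans (eval𝔹 (λ _ → gad x) (τ f)) (run-𝔹-gad (proj₁ (parseσ (τ f))) x)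
      iter-gad : ∀ x → gad (iter o (runG w) x) ≡ iter o (app B turn) (gad x)
      iter-gad = iter-natural gad (λ x → sym (app-gad turn x)) o
      closed : ∀ x → T (designated x) → T (designated (iter o (runG w) x))
      closed x d = D⇒designated i _ (subst D₀ (sym (iter-gad x)) (has-turn (gad x) (designated⇒D i x d)))
      dc : T (designated c)
      dc = D⇒designated i c (subst D₀ (app-gad truth 𝟏) (has-truth (gad 𝟏)))
      escapes : ¬ T (designated (runG w (iter o (runG w) c)))
      escapes d = ⊥ᵖ-elim (explodes (gad 𝟏) (gad α) (subst D₀ e (designated⇒D i _ d)))
        where
        -- The exploding rule is aimed at `gad α`, an undesignated element.
        e : gad (runG w (iter o (runG w) c)) ≡
            app B turn (iter o (app B turn) (app B truth (gad 𝟏)))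
        e = trans (sym (app-gad turn _)) (cong (app B turn)
              (trans (iter-gad c) (cong (iter o (app B turn)) (sym (app-gad truth 𝟏)))))

    turnTerm-𝔸 : ∀ o → ∃ λ q → Turns o q × (∀ p → eval 𝔸σ (λ _ → lift p) (turnTerm o) ≡ lift (runP (pureWord q) p))
    turnTerm-𝔸 o with turn-rigid o
    ... | q , t , e = q , t , λ p → trans (eval𝔸 (λ _ → lift p) (turnTerm o)) (cong lift (e p))

    pulled-filter : ∀ {H} → IsFilter 𝓢 𝔹σ H → IsFilter 𝓢 𝔸σ (H ∘ φ ∘ lower)
    pulled-filter {H} fil Γ χ v d h = subst H (sym (e χ)) (fil Γ χ (φ ∘ lower ∘ v) d λ ψ x → subst H (e ψ) (h ψ x))
      where
      e : ∀ t → φ (lower (eval 𝔸σ v t)) ≡ eval 𝔹σ (φ ∘ lower ∘ v) t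
      e t = trans (cong (φ ∘ lower) (eval𝔸 v t)) (trans (φ-run (proj₁ (parseσ t)) _) (sym (eval𝔹 _ t)))

    chosen : Bool → Pt → Bool
    chosen b (gad x) = designated x
    chosen b (pt c)  = b ≡ᵇ c

    -- Chosen to violate a cyclic rule: the square of `turn two` leads out of `G false`, the cube of
    -- `turn three` out of `G true`.
    G : Bool → Pred (Lift ℓ Pt) ℓ
    G b p = Lift ℓ (T (chosen b (lower p)))

    G⊆ : ∀ b p → G b p → D₀ (φ (lower p))
    G⊆ b (lift (gad x)) (lift d) = designated⇒D i x d
    G⊆ b (lift (pt c))  _        = _

    module _ {b : Bool} (filG : IsFilter 𝓢 𝔸σ (G b)) {θ : Rel (Lift ℓ Pt) ℓ}
             (θ-cong : IsCongruence 𝓢 𝔸σ θ)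
             (θ-compat : ∀ H → IsFilter 𝓢 𝔸σ H → G b ⊆ H → Compatible 𝓢 𝔸σ θ H) where

      private
        open IsEquivalence (proj₁ θ-cong) using () renaming (sym to θ-sym; trans to θ-trans)

        θ-G : ∀ {p q} → θ (lift p) (lift q) → T (chosen b p) → T (chosen b q)
        θ-G r t = lower (θ-compat (G b) filG id _ _ r (lift t))

        θ-D : ∀ {p q} → θ (lift p) (lift q) → D₀ (φ p) → D₀ (φ q)
        θ-D = θ-compat _ (pulled-filter {D₀} (proj₁ mod𝔹)) (λ {p} → G⊆ b p) _ _

        θ-turn : ∀ o {p q} → θ (lift p) (lift q) → ∃ λ π → Turns o π ×
                 θ (lift (runP (pureWord π) p)) (lift (runP (pureWord π) q))
        θ-turn o {p} {q} r with turnTerm-𝔸 o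
        ... | π , t , e = π , t , subst₂ θ (e p) (e q)
          (congruence-eval 𝓢 𝔸σ θ-cong (λ _ → lift p) (λ _ → lift q) (λ _ → r) (turnTerm o))

        -- 𝔹 is reduced for 𝓢, hence so is its gadget part.
        data Image : Rel (El I) ℓ where
          same : ∀ {x} → Image x x
          image : ∀ {x y} → θ (lift (gad x)) (lift (gad y)) → Image (gad x) (gad y)

        θ-gad : ∀ {x y} → θ (lift (gad x)) (lift (gad y)) → x ≡ y
        θ-gad r = El-gad-injective (proj₂ mod𝔹 _ _ (Image , (equivalence , congruent) , compatible , image r))
          where
          El-gad-injective : ∀ {x y} → El.gad {I = I} x ≡ gad y → x ≡ y
          El-gad-injective refl = refl
          equivalence : IsEquivalence Image
          equivalence = record
            { refl  = same
            ; sym   = λ { same → same ; (image r) → image (θ-sym r) }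
            ; trans = λ { same q → q ; (image r) same → image r
                        ; (image r) (image s) → image (θ-trans r s) }
            }
          congruent : ∀ f (as bs : Fin (ar (lang 𝓢) f) → El I) → (∀ k → Image (as k) (bs k)) →
                      Image (op 𝔹σ f as) (op 𝔹σ f bs)
          congruent f as bs h = subst₂ Image (sym (e as)) (sym (e bs)) (go (h k))
            where
            w = proj₁ (parse (σ f))
            k = proj₂ (parse (σ f))
            e : ∀ cs → op 𝔹σ f cs ≡ run (𝔹 I) w (cs k)
            e cs = eval-parse (𝔹 I) (λ _ _ → refl) cs (σ f)
            e𝔸 : ∀ p → op 𝔸σ f (λ _ → lift p) ≡ lift (runP (spell w) p)
            e𝔸 p = trans (eval-parse 𝔸 (λ _ _ → refl) (λ _ → lift p) (σ f)) (run-𝔸 w p)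
            go : ∀ {x y} → Image x y → Image (run (𝔹 I) w x) (run (𝔹 I) w y)
            go same             = same
            go (image {x} {y} r) = subst₂ Image (sym (run-𝔹-gad w x)) (sym (run-𝔹-gad w y))
              (image (subst₂ θ (trans (e𝔸 (gad x)) (cong lift (runP-gad (spell w) x)))
                              (trans (e𝔸 (gad y)) (cong lift (runP-gad (spell w) y)))
                (proj₂ θ-cong f _ _ (λ _ → r))))
          compatible : ∀ H → IsFilter 𝓢 𝔹σ H → D₀ ⊆ H → Compatible 𝓢 𝔹σ Image H
          compatible H filH D⊆H _ _ same     h = h
          compatible H filH D⊆H _ _ (image r) h = θ-compat _ (pulled-filter {H} filH) (λ {p} g → D⊆H (G⊆ b p g)) _ _ r h

        θ-pt : ∀ {c d} → θ (lift (pt c)) (lift (pt d)) → c ≡ d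
        θ-pt r = ≡ᵇ-cancel b _ _ (T-≡ (θ-G r) (θ-G (θ-sym r)))
          where
          ≡ᵇ-cancel : ∀ b c d → (b ≡ᵇ c) ≡ (b ≡ᵇ d) → c ≡ d
          ≡ᵇ-cancel false false false _ = refl
          ≡ᵇ-cancel false true  true  _ = refl
          ≡ᵇ-cancel true  false false _ = refl
          ≡ᵇ-cancel true  true  true  _ = refl

        -- The pullback of `D₀` contains the points, which leaves only `𝟏` and `Ω`. The first is
        -- moved to the undesignated `α` by `turn two`. The second is fixed by both turns, so both
        -- points would be related to it and lie in `G b`.
        ¬θ-pt-gad : ∀ {c} x → θ (lift (pt c)) (lift (gad x)) → ⊥₀
        ¬θ-pt-gad 𝟏 r with θ-turn two r
        ... | _ , two₁ , r′ = ⊥ᵖ-elim (θ-D r′ _)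
        ¬θ-pt-gad Ω r with θ-turn two r | θ-turn three r
        ... | _ , two₁ , r′ | _ , three₁ , r″ = go b (θ-G (θ-sym r′) _) (θ-G (θ-sym r″) _)
          where
          go : ∀ b → T (b ≡ᵇ true) → T (b ≡ᵇ false) → ⊥₀
          go true _ ()
        ... | _ , two₁ , r′ | _ , three₂ , r″ = go b (θ-G (θ-sym r′) _) (θ-G (θ-sym r″) _)
          where
          go : ∀ b → T (b ≡ᵇ true) → T (b ≡ᵇ false) → ⊥₀
          go true _ ()
        ¬θ-pt-gad α  r = ⊥ᵖ-elim (θ-D r _)
        ¬θ-pt-gad β₁ r = ⊥ᵖ-elim (θ-D r _)
        ¬θ-pt-gad β₂ r = ⊥ᵖ-elim (θ-D r _)
        ¬θ-pt-gad ∞  r = ⊥ᵖ-elim (θ-D r _)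
        ¬θ-pt-gad 𝟏′ r = ⊥ᵖ-elim (θ-D r _)
        ¬θ-pt-gad Ω′ r = ⊥ᵖ-elim (θ-D r _)
        ¬θ-pt-gad Ω″ r = ⊥ᵖ-elim (θ-D r _)

      𝔸-separated : ∀ {p q} → θ (lift p) (lift q) → p ≡ q
      𝔸-separated {gad x} {gad y} r = cong gad (θ-gad r)
      𝔸-separated {pt c}  {pt d}  r = cong pt (θ-pt r)
      𝔸-separated {gad x} {pt d}  r = ⊥-elim (¬θ-pt-gad x (θ-sym r))
      𝔸-separated {pt c}  {gad y} r = ⊥-elim (¬θ-pt-gad y r)

    -- An interpretation speaks of reduced matrices only, so the cyclic rules do not apply to
    -- arbitrary filters of `𝓢`. But if `G b` were a filter, `𝔸-separated` would make its matrix
    -- reduced, and a cyclic rule would fail in it.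
    ¬G-filter : ∀ b → ¬ IsFilter 𝓢 𝔸σ (G b)
    ¬G-filter b filG = go b mod
      where
      mod : InModS 𝓢 𝔸σ (G b)
      mod = filG , λ { (lift p) (lift q) (θ , θ-cong , θ-compat , r) →
                       cong lift (𝔸-separated filG θ-cong θ-compat r) }
      moves : ∀ o b → InModS 𝓢 𝔸σ (G b) → ∀ q → G b (lift (pt b)) →
              (∀ p → eval 𝔸σ (λ _ → lift p) (turnTerm o) ≡ lift (runP (pureWord q) p)) →
              G b (iter o (lift ∘ runP (pureWord q) ∘ lower) (lift (pt b)))
      moves o b mod q g e = subst (G b) (iter-cong (λ p → e (lower p)) o _)
        (CyclicFilter.has-turn (toCyclicFilter ℓ {o} (𝔸σ ^[ proj₁ (bound o) ]) {G b}
          (proj₁ (proj₂ (bound o) 𝔸σ (G b) mod))) (lift (pt b)) g)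
      go : ∀ b → InModS 𝓢 𝔸σ (G b) → ⊥₀
      go false mod with turnTerm-𝔸 two
      ... | _ , two₁ , e = lower (moves two false mod two₁ _ e)
      go true mod with turnTerm-𝔸 three
      ... | _ , three₁ , e = lower (moves three true mod three₁ _ e)
      ... | _ , three₂ , e = lower (moves three true mod three₂ _ e)

    Witness : Bool → Set (lsuc ℓ)
    Witness b = Σ[ Γ ∈ Pred (Fm 𝓢) ℓ ] Σ[ χ ∈ Fm 𝓢 ] Σ[ v ∈ (Var 𝓢 → Lift ℓ Pt) ]
      ((𝓢 ⊢ Γ) χ × (∀ ψ → ψ ∈ Γ → G b (eval 𝔸σ v ψ)) × eval 𝔸σ v χ ≡ lift (pt (not b)))

    -- The conclusion takes its value in the pullback of `D₀`, which exceeds `G b` by the point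
    -- `pt (not b)` alone. Hence a failure of the filter condition must hit exactly this point.
    ¬¬witness : ∀ b → ¬ ¬ Witness b
    ¬¬witness b no = ¬G-filter b λ Γ χ v d h →
      check (λ e → no (Γ , χ , v , d , h , e))
        (pulled-filter {D₀} (proj₁ mod𝔹) Γ χ v d (λ ψ x → G⊆ b _ (h ψ x)))
      where
      check : ∀ {p} → p ≢ lift (pt (not b)) → D₀ (φ (lower p)) → G b p
      check {lift (gad x)} ne d = lift (D⇒designated i x d)
      check {lift (pt c)}  ne d = lift (go b c λ { refl → ne refl })
        where
        go : ∀ b c → c ≢ not b → T (b ≡ᵇ c)
        go false false _  = _
        go false true  ne = ⊥-elim (ne refl)
        go true  false ne = ⊥-elim (ne refl)
        go true  true  _  = _

    -- Reading each point as the corresponding bit of `cop Z` lifts the valuation of the witness to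
    -- `𝔹`. The formulas avoid probe `i`, so their values stay related, and `pt (not b)` is related
    -- to nothing but `bit (cop Z) (not b)`.
    transfer : ∀ {b} → Witness b → ∀ {H} → IsFilter 𝓢 𝔹σ H → D₀ ⊆ H →
               ∀ Z → H (bit (cop Z) b) → H (bit (cop Z) (not b))
    transfer {b} (Γ , χ , v , d , h , e) {H} filH D⊆H Z hb =
      target (subst (λ p → i ∣ Z ∣ lower p ∼ eval 𝔹σ v̂ χ) e (related χ))
        (filH Γ χ v̂ d λ ψ x → source (related ψ) (lower (h ψ x)))
      where
      v̂ : Var 𝓢 → El I
      v̂ = section Z ∘ lower ∘ v
      related : ∀ t → i ∣ Z ∣ lower (eval 𝔸σ v t) ∼ eval 𝔹σ v̂ t
      related t = subst₂ (λ p x → i ∣ Z ∣ lower p ∼ x) (sym (eval𝔸 v t)) (sym (eval𝔹 v̂ t))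
        (∼-run (avoids-parseσ t) (∼-section Z _))
      ≡ᵇ-sound : ∀ b c → T (b ≡ᵇ c) → b ≡ c
      ≡ᵇ-sound false false _ = refl
      ≡ᵇ-sound true  true  _ = refl
      source : ∀ {p x} → i ∣ Z ∣ p ∼ x → T (chosen b p) → H x
      source (same {x})          t = D⊆H (designated⇒D i x t)
      source (tag∼ {b = true}  n) t = D⊆H _
      source (tag∼ {b = false} n) t = D⊆H n
      source (pt∼ {c}) t with refl ← ≡ᵇ-sound b c t = hb
      target : ∀ {x} → i ∣ Z ∣ pt (not b) ∼ x → H x → H (bit (cop Z) (not b))
      target pt∼ hx = hx

    contradiction : ⊥₀
    contradiction = ¬¬witness false λ W₀ → ¬¬witness true λ W₁ → collapse W₀ W₁
      where
      collapse : Witness false → Witness true → ⊥₀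
      -- The two witnesses make the bits of every copied pair inseparable; `cop (tag i)` is one such
      -- pair.
      collapse W₀ W₁ = bits (proj₂ mod𝔹 (bit (cop (tag i)) true) (bit (cop (tag i)) false)
                              ((i ∣_≈_) , (equivalence , congruent) , compatible , soft cop))
        where
        bits : ∀ {X} → bit {I = I} X true ≢ bit X false
        bits ()
        equivalence : IsEquivalence (i ∣_≈_)
        equivalence = record { refl = same ; sym = ≈-sym ; trans = ≈-trans }
        congruent : ∀ f (as bs : Fin (ar (lang 𝓢) f) → El I) → (∀ k → i ∣ as k ≈ bs k) →
                    i ∣ op 𝔹σ f as ≈ op 𝔹σ f bs
        congruent f as bs h = subst₂ (i ∣_≈_) (sym (e as)) (sym (e bs)) (≈-run (avoids f) (h _))
          where
          e : ∀ cs → op 𝔹σ f cs ≡ run (𝔹 I) (proj₁ (parse (σ f))) (cs (proj₂ (parse (σ f))))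
          e cs = eval-parse (𝔹 I) (λ _ _ → refl) cs (σ f)
        compatible : ∀ H → IsFilter 𝓢 𝔹σ H → D₀ ⊆ H → Compatible 𝓢 𝔹σ (i ∣_≈_) H
        compatible H filH D⊆H _ _ same                             h = h
        compatible H filH D⊆H _ _ (soft {b = _} {true}  (tag n))   h = D⊆H _
        compatible H filH D⊆H _ _ (soft {b = _} {false} (tag n))   h = D⊆H n
        compatible H filH D⊆H _ _ (soft {b = false} {false} cop)   h = h
        compatible H filH D⊆H _ _ (soft {b = false} {true}  cop)   h = transfer W₀ filH D⊆H _ h
        compatible H filH D⊆H _ _ (soft {b = true}  {false} cop)   h = transfer W₁ filH D⊆H _ h
        compatible H filH D⊆H _ _ (soft {b = true}  {true}  cop)   h = h

-- A translation uses only countably many probes per symbol, so some probe indexed by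
-- Sym × ℕ → Bool escapes it.
module Diagonal {ℓ : Level} (X : Set ℓ) where

  Index : Set ℓ
  Index = X × ℕ → Bool

  -- Positions without a probe or beyond the end of the word receive the constant `false` as a
  -- default.
  at : Word Index → ℕ → Index
  at []            n       = λ _ → false
  at (_ ∷ w)       (suc n) = at w n
  at (probe k ∷ w) zero    = k
  at (_ ∷ w)       zero    = λ _ → false

  avoids-at : ∀ {i} w → (∀ n → at w n ≢ i) → Avoids i w
  avoids-at []      h = []
  avoids-at (f ∷ w) h = (λ { refl → h zero refl }) ∷ avoids-at w (h ∘ suc)

  diagonal : (X → Word Index) → Index
  diagonal ws (x , n) = not (at (ws x) n (x , n))

  avoids-diagonal : ∀ ws x → Avoids (diagonal ws) (ws x)
  avoids-diagonal ws x = avoids-at (ws x) λ n e → not-¬ (sym (cong (λ k → k (x , n)) e)) refl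

theorem5p1 : (ℓ : Level) →
    Σ[ 𝓛 ∈ Logic ℓ ] Σ[ 𝓛′ ∈ Logic ℓ ] ¬ HasSup 𝓛 𝓛′
theorem5p1 ℓ = cyclic ℓ two , cyclic ℓ three , λ (𝓢 , two≤𝓢 , three≤𝓢 , least) →
  let open Diagonal (Sym (lang 𝓢))
      -- The upper bound is chosen after `𝓢`, with its probes indexed over the symbols of `𝓢`.
      σ , interprets = least (upper Index) (cyclic≤upper Index two) (cyclic≤upper Index three)
      words = λ f → proj₁ (parse (σ f))
  in Contradiction.contradiction 𝓢 (λ { two → two≤𝓢 ; three → three≤𝓢 }) σ interprets
       (diagonal words) (avoids-diagonal words)
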